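{- Let $K$ be a finite extension of $K_0=\mathbb{F}_q(T)$, and let $\phi,\psi$ be isogenous Drinfeld modules defined over $K$. For any finite place $v$ of $K$, $\phi$ has stable reduction at $v$ if and only if $\psi$ has stable reduction at $v$.
   Context: $\mathbb{F}_q$ is a finite field with $q$ elements, $A=\mathbb{F}_q[T]$. $K\{\tau\}$ is the ring of twisted polynomials $\sum_i f_i\tau^i$ ($f_i\in K$) with $\tau c=c^q\tau$ for $c\in K$. A Drinfeld module of rank $r\geqslant1$ over $K$ is an $\mathbb{F}_q$-algebra homomorphism $\phi:A\to K\{\tau\}$, $a\mapsto\phi_a$, such that for every $a\in A$ the constant coefficient of $\phi_a$ is $a$, and $\deg_\tau\phi_a=r\deg_T a$. Two Drinfeld modules $\phi,\psi$ over $K$ are isogenous if there is an isogeny $f:\phi\to\psi$, i.e. a nonzero $f\in K\{\tau\}$ with $f\cdot\phi_a=\psi_a\cdot f$ for all $a\in A$ (they then have the same rank). Each place $v$ of $K$ gives a valuation $\mathrm{ord}_v:K\to\mathbb{Z}\cup\{\infty\}$ normalized by $\mathrm{ord}_v(K^*)=\mathbb{Z}$. A place of $K$ is infinite if it lies above the place $\infty$ of $K_0$ (given by $\mathrm{ord}_\infty(a)=-\deg a$ for $a\in A$), and finite otherwise. A Drinfeld module $\phi$ of rank $r$ over $K$ has stable reduction at $v$ if there is $c\in K^*$ such that, writing $c^{ -1}\cdot\phi_T\cdot c=T+\sum_{i=1}^r g_i\tau^i$ with $g_i\in K$, one has $\min\{\mathrm{ord}_v(g_i):1\leqslant i\leqslant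 r\}=0$. -}

module Defs where

open import Level using (Level; _⊔_) renaming (suc to lsuc)
open import Algebra.Bundles using (CommutativeRing; RawRing)
open import Algebra.Definitions using (Invertible)
import Algebra.Construct.NaturalChoice.Min as Min
import Algebra.Definitions.RawMonoid as RawMonoidDefinitions
import Algebra.Definitions.RawSemiring as RawSemiringDefinitions
open import Algebra.Morphism.Structures using (IsRingHomomorphism; IsRingMonomorphism)
open import Data.Fin.Base using (Fin)
open import Data.Integer.Base as ℤ using (ℤ; +_; 0ℤ)
import Data.Integer.Properties as ℤ
open import Data.List.Base using (List; []; _∷_; map)
open import Data.Maybe.Base as Maybe using (zipWith)
open import Data.Nat.Base as ℕ using (ℕ; zero; suc; NonZero)
open import Data.Product.Base using (∃₂; Σ-syntax; ∃-syntax; _×_; proj₁)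
open import Data.Vec.Functional using (Vector; foldr; toList)
open import Function.Base using (id; _∘_)
open import Function.Bundles using (Inverse; _⇔_)
open import Relation.Binary.Bundles using (TotalOrder)
open import Relation.Binary.PropositionalEquality.Core using (_≡_)
import Relation.Binary.PropositionalEquality.Properties as ≡
import Relation.Binary.Construct.Add.Supremum.NonStrict as AddSupremum
open import Relation.Nullary.Construct.Add.Supremum using (_⁺; ⊤⁺; [_])
open import Relation.Nullary.Negation.Core using (¬_)

record Field (c ℓ : Level) : Set (lsuc (c ⊔ ℓ)) where
  field
    commutativeRing : CommutativeRing c ℓ
  open CommutativeRing commutativeRing public
  field
    0≉1        : ¬ (0# ≈ 1#)
    invertible : ∀ {x} → ¬ (x ≈ 0#) → Invertible _≈_ 1# _*_ x

  inv : ∀ {x} → ¬ (x ≈ 0#) → Carrier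
  inv x≉0 = proj₁ (invertible x≉0)

record FiniteField (q : ℕ) (c ℓ : Level) : Set (lsuc (c ⊔ ℓ)) where
  field
    𝔽 : Field c ℓ
  open Field 𝔽 public
  field
    enumeration : Inverse (≡.setoid (Fin q)) setoid

-- R[X;σ]: the list f₀ ∷ f₁ ∷ … stands for Σ fᵢ Xⁱ, coefficients on the left,
-- with X c = σ(c) X.  Trailing zeros are allowed, so equality is coefficientwise.
-- σ is meant to be a ring endomorphism of R; only its values enter the definitions.
module SkewPolynomial {c ℓ} (R : CommutativeRing c ℓ)
                      (σ : CommutativeRing.Carrier R → CommutativeRing.Carrier R) where
  private module R = CommutativeRing R

  Poly : Set c
  Poly = List R.Carrier

  coeff : Poly → ℕ → R.Carrier
  coeff []      _       = R.0#
  coeff (x ∷ _) zero    = x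
  coeff (_ ∷ f) (suc i) = coeff f i

  infixl 6 _+_
  infixl 7 _*_

  _+_ : Poly → Poly → Poly
  []      + g       = g
  (x ∷ f) + []      = x ∷ f
  (x ∷ f) + (y ∷ g) = (x R.+ y) ∷ (f + g)

  -- (x + f X) g = x g + f σ(g) X
  _*_ : Poly → Poly → Poly
  []      * g = []
  (x ∷ f) * g = map (x R.*_) g + (R.0# ∷ (f * map σ g))

  C : R.Carrier → Poly
  C x = x ∷ []

  X : Poly
  X = R.0# ∷ R.1# ∷ []

  rawRing : RawRing c ℓ
  rawRing = record
    { Carrier = Poly
    ; _≈_     = λ f g → ∀ i → coeff f i R.≈ coeff g i
    ; _+_     = _+_
    ; _*_     = _*_
    ; -_      = map (R.-_)
    ; 0#      = []
    ; 1#      = C R.1#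
    }

  HasDegree : Poly → ℕ → Set ℓ
  HasDegree f d = ¬ (coeff f d R.≈ R.0#) × (∀ i → d ℕ.< i → coeff f i R.≈ R.0#)

module Polynomial {c ℓ} (R : CommutativeRing c ℓ) = SkewPolynomial R id

module TwistedPolynomial {c ℓ} (q : ℕ) (K : Field c ℓ) =
  SkewPolynomial (Field.commutativeRing K)
    (λ x → RawSemiringDefinitions._^_ (RawRing.rawSemiring (Field.rawRing K)) x q)

-- A field of fractions of F[T], i.e. F(T) up to unique isomorphism over F[T].
record RationalFunctionField {c ℓ} (F : Field c ℓ) (c₀ ℓ₀ : Level)
                             : Set (c ⊔ ℓ ⊔ lsuc (c₀ ⊔ ℓ₀)) where
  private
    module A = Polynomial (Field.commutativeRing F)
  field
    K₀ : Field c₀ ℓ₀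
  open Field K₀
  field
    fromA      : A.Poly → Carrier
    fromA-mono : IsRingMonomorphism A.rawRing rawRing fromA
    fraction   : ∀ x → ∃₂ λ a b →
                 ¬ (fromA b ≈ 0#) × (x * fromA b ≈ fromA a)

record FiniteExtension {c₀ ℓ₀} (K₀ : Field c₀ ℓ₀) (c ℓ : Level)
                       : Set (c₀ ⊔ ℓ₀ ⊔ lsuc (c ⊔ ℓ)) where
  field
    K : Field c ℓ
  open Field K
  open RawMonoidDefinitions (RawRing.+-rawMonoid rawRing) using (sum)
  field
    ι      : Field.Carrier K₀ → Carrier
    ι-homo : IsRingHomomorphism (Field.rawRing K₀) rawRing ι
    finite : ∃[ n ] Σ[ e ∈ Vector Carrier n ]
             (∀ x → Σ[ a ∈ Vector (Field.Carrier K₀) n ]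
                      x ≈ sum (λ i → ι (a i) * e i))

open AddSupremum ℤ._≤_ public using (_≤⁺_)

ℤ⁺-totalOrder : TotalOrder _ _ _
ℤ⁺-totalOrder = record
  { isTotalOrder = AddSupremum.≤⁺-isTotalOrder-≡ ℤ._≤_ ℤ.≤-isTotalOrder }

open Min ℤ⁺-totalOrder public using () renaming (_⊓_ to _⊓⁺_)

infixl 6 _+⁺_
_+⁺_ : ℤ ⁺ → ℤ ⁺ → ℤ ⁺
_+⁺_ = zipWith ℤ._+_

infixl 7 _·⁺_
_·⁺_ : ℕ → ℤ ⁺ → ℤ ⁺
e ·⁺ x = Maybe.map (+ e ℤ.*_) x

minimum⁺ : ∀ {n} → Vector (ℤ ⁺) n → ℤ ⁺
minimum⁺ = foldr _⊓⁺_ ⊤⁺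

-- A place is represented by its normalized valuation.
record Place {c ℓ} (K : Field c ℓ) : Set (c ⊔ ℓ) where
  open Field K
  field
    ord            : Carrier → ℤ ⁺
    ord-cong       : ∀ {x y} → x ≈ y → ord x ≡ ord y
    ord-∞          : ∀ {x} → ord x ≡ ⊤⁺ ⇔ x ≈ 0#
    ord-*          : ∀ x y → ord (x * y) ≡ ord x +⁺ ord y
    ord-+          : ∀ x y → ord x ⊓⁺ ord y ≤⁺ ord (x + y)
    ord-surjective : ∀ n → ∃[ x ] ord x ≡ [ n ]

module _ {c₀ ℓ₀ c ℓ} {K₀ : Field c₀ ℓ₀} (ext : FiniteExtension K₀ c ℓ) where
  open FiniteExtension ext

  -- e is the ramification index.
  LiesAbove : Place K → Place K₀ → Set c₀
  LiesAbove v w = ∃[ e ] NonZero e × (∀ x → Place.ord v (ι x) ≡ e ·⁺ Place.ord w x)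

module Drinfeld {q c𝔽 ℓ𝔽 c₀ ℓ₀ c ℓ}
                (𝔽q : FiniteField q c𝔽 ℓ𝔽)
                (rat : RationalFunctionField (FiniteField.𝔽 𝔽q) c₀ ℓ₀)
                (ext : FiniteExtension (RationalFunctionField.K₀ rat) c ℓ) where
  open RationalFunctionField rat using (K₀; fromA)
  open FiniteExtension ext using (K; ι)
  private
    module K  = Field K
    module A  = Polynomial (FiniteField.commutativeRing 𝔽q)
    module Kτ = TwistedPolynomial q K
  open RawRing Kτ.rawRing using (_≈_; _*_; 0#)

  γ : A.Poly → K.Carrier
  γ = ι ∘ fromA

  Is∞ : Place K₀ → Set (c𝔽 ⊔ ℓ𝔽)
  Is∞ w = ∀ a d → A.HasDegree a d → Place.ord w (fromA a) ≡ [ ℤ.- (+ d) ]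

  IsInfinite : Place K → Set (c𝔽 ⊔ ℓ𝔽 ⊔ c₀ ⊔ ℓ₀)
  IsInfinite v = ∃[ w ] Is∞ w × LiesAbove ext v w

  IsFinite : Place K → Set (c𝔽 ⊔ ℓ𝔽 ⊔ c₀ ⊔ ℓ₀)
  IsFinite v = ¬ IsInfinite v

  record DrinfeldModule (r : ℕ) : Set (c𝔽 ⊔ ℓ𝔽 ⊔ c ⊔ ℓ) where
    field
      rank≥1   : 1 ℕ.≤ r
      φ        : A.Poly → Kτ.Poly
      φ-homo   : IsRingHomomorphism A.rawRing Kτ.rawRing φ
      φ-const  : ∀ x → φ (A.C x) ≈ Kτ.C (γ (A.C x))
      φ-coeff₀ : ∀ a → Kτ.coeff (φ a) 0 K.≈ γ a
      φ-degree : ∀ a d → A.HasDegree a d → Kτ.HasDegree (φ a) (r ℕ.* d)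

  open DrinfeldModule

  IsIsogeny : ∀ {r s} → DrinfeldModule r → DrinfeldModule s → Kτ.Poly → Set (c𝔽 ⊔ ℓ)
  IsIsogeny D E f = ¬ (f ≈ 0#) × (∀ a → f * φ D a ≈ φ E a * f)

  Isogenous : ∀ {r s} → DrinfeldModule r → DrinfeldModule s → Set (c𝔽 ⊔ c ⊔ ℓ)
  Isogenous D E = ∃[ f ] IsIsogeny D E f

  -- The list γ T ∷ toList g is T + Σ gᵢ τⁱ with 1 ≤ i ≤ r; the vector g is
  -- indexed from 0, so its entry at index i is the coefficient of τⁱ⁺¹.
  HasStableReduction : ∀ {r} → DrinfeldModule r → Place K → Set (c ⊔ ℓ)
  HasStableReduction {r} D v =
    ∃[ x ] Σ[ x≉0 ∈ ¬ (x K.≈ K.0#) ] Σ[ g ∈ Vector K.Carrier r ]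
      (Kτ.C (K.inv x≉0) * φ D A.X * Kτ.C x ≈ γ A.X ∷ toList g)
      × (minimum⁺ (Place.ord v ∘ g) ≡ [ 0ℤ ])

{-# OPTIONS --safe #-}

-- Let w be a valuation of K.  For integers a, b consider the least of the
-- values w(fᵢ) + qⁱ a − b, i.e. the Gauss value of y⁻¹ f x with w(x) = a and
-- w(y) = b.  The last index at which this minimum occurs behaves like the degree
-- of a reduction mod v: for a product of twisted polynomials the minimum and its
-- last index can be read off from the factors.  Since T is v-integral, φ has
-- stable reduction exactly when, for some integer a = b, φ_T has minimum 0 with
-- last index ≥ 1.  Now let f φ_T = ψ_T f.
--   If φ_T is normalized by a, choose b such that f has minimum 0 for (a, b);
-- comparing both sides of f φ_T = ψ_T f shows that ψ_T is normalized by b, with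
-- the same last index.
--   If ψ_T is normalized by b, the required a satisfies min (w(fᵢ) + qⁱ a) = b and
-- is a priori only in ℤ[1/q]; so w and b are first multiplied by a power of q.  Again
-- φ_T is normalized by a.  At the last index k ≥ 1 this says
-- w(g_k) + (qᵏ − 1) a = 0 for the coefficient g_k of φ_T, and as qᵏ − 1 is prime
-- to q, the original a is an integer.
--   That T is v-integral at a finite place is shown by contraposition: if
-- w(T) = −e < 0, then w(h) = −e deg h for h ∈ 𝔽_q[T], so v lies above ∞.
module Submission where

open import Defs
open import Algebra.Bundles using (CommutativeRing; RawRing)
import Algebra.Construct.NaturalChoice.Min as Min
import Algebra.Definitions.RawSemiring as RawSemiringDefinitions
open import Algebra.Morphism.Structures using (IsRingHomomorphism; IsRingMonomorphism)
import Algebra.Properties.Ring as RingProperties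
open import Data.Fin.Base using (zero; suc; toℕ; fromℕ<)
open import Data.Fin.Properties as Fin using (nonZeroIndex)
open import Data.Integer.Base as ℤ using (ℤ; +_; -[1+_]; 0ℤ; 1ℤ)
import Data.Integer.Properties as ℤ
open import Data.Integer.Tactic.RingSolver using (solve-∀)
open import Data.List.Base as List using ([]; _∷_; map)
open import Data.Nat.Base as ℕ using (ℕ; zero; suc; NonZero; z≤n; s≤s)
import Data.Nat.Properties as ℕ
open import Data.Product.Base using (∃; ∃₂; _,_; _×_; proj₁; proj₂)
open import Data.Sum.Base using (_⊎_; inj₁; inj₂)
open import Data.Vec.Functional using (Vector; toList)
open import Function.Base using (_∘_; id)
open import Function.Bundles using (_⇔_; Equivalence; Inverse; mk⇔)
open import Level using (Level; _⊔_)
open import Relation.Binary.Bundles using (TotalOrder)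
import Relation.Binary.Construct.Add.Supremum.NonStrict as AddSupremum
open import Relation.Binary.Definitions using (tri<; tri≈; tri>)
open import Relation.Binary.PropositionalEquality
import Relation.Binary.Reasoning.Setoid as SetoidReasoning
open import Relation.Nullary.Construct.Add.Supremum using (_⁺; ⊤⁺; [_])
open import Relation.Nullary.Decidable.Core using (Dec; yes; no; map′)
open import Relation.Nullary.Negation.Core using (¬_; contradiction)

open AddSupremum ℤ._≤_ using (_≤⊤⁺; [≤]-injective) renaming ([_] to [_]≤)
open TotalOrder ℤ⁺-totalOrder using () renaming
  (trans to ≤⁺-trans; reflexive to ≤⁺-reflexive; antisym to ≤⁺-antisym)
open Min ℤ⁺-totalOrder using (x⊓y≤x; x⊓y≤y; ⊓-glb; ⊓-sel)

open RingProperties ℤ.+-*-ring using (x+x≈x⇒x≈0)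

private
  variable
    c ℓ : Level
    m n t μ ν : ℤ
    x y z : ℤ ⁺
    i j k : ℕ

-- Arithmetic and order of the integers extended by infinity

[]-injective : ∀ {m n : ℤ} → _≡_ {A = ℤ ⁺} [ m ] [ n ] → m ≡ n
[]-injective refl = refl

suc-≰ : ¬ ([ ℤ.suc n ] ≤⁺ [ n ])
suc-≰ [ p ]≤ = ℤ.<-irrefl refl (ℤ.suc[i]≤j⇒i<j p)

suc≤⇒≤ : [ ℤ.suc n ] ≤⁺ x → [ n ] ≤⁺ x
suc≤⇒≤ = ≤⁺-trans [ ℤ.i≤suc[i] _ ]≤

+⁺-zeroʳ : ∀ x → x +⁺ ⊤⁺ ≡ ⊤⁺
+⁺-zeroʳ ⊤⁺    = refl
+⁺-zeroʳ [ _ ] = refl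

+⁺-identityˡ : ∀ x → [ 0ℤ ] +⁺ x ≡ x
+⁺-identityˡ ⊤⁺    = refl
+⁺-identityˡ [ n ] = cong [_] (ℤ.+-identityˡ n)

+⁺-identityʳ : ∀ x → x +⁺ [ 0ℤ ] ≡ x
+⁺-identityʳ ⊤⁺    = refl
+⁺-identityʳ [ n ] = cong [_] (ℤ.+-identityʳ n)

+⁺-shift : [ m ℤ.- t ] ≤⁺ x → [ m ] ≤⁺ x +⁺ [ t ]
+⁺-shift {x = ⊤⁺}            _      = _ ≤⊤⁺
+⁺-shift {m} {t} {x = [ n ]} [ p ]≤ =
  [ subst (ℤ._≤ n ℤ.+ t) (lemma m t) (ℤ.+-monoˡ-≤ t p) ]≤
  where
  lemma : ∀ m t → m ℤ.- t ℤ.+ t ≡ m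
  lemma = solve-∀

+⁺-unshift : [ m ] ≤⁺ x +⁺ [ t ] → [ m ℤ.- t ] ≤⁺ x
+⁺-unshift {x = ⊤⁺}            _      = _ ≤⊤⁺
+⁺-unshift {m} {x = [ n ]} {t} [ p ]≤ =
  [ subst (m ℤ.- t ℤ.≤_) (lemma n t) (ℤ.+-monoˡ-≤ (ℤ.- t) p) ]≤
  where
  lemma : ∀ n t → n ℤ.+ t ℤ.- t ≡ n
  lemma = solve-∀

1·⁺ : ∀ x → 1 ·⁺ x ≡ x
1·⁺ ⊤⁺    = refl
1·⁺ [ n ] = cong [_] (ℤ.*-identityˡ n)

·⁺-assoc : ∀ d e x → d ·⁺ (e ·⁺ x) ≡ (d ℕ.* e) ·⁺ x
·⁺-assoc d e ⊤⁺    = refl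
·⁺-assoc d e [ n ] = cong [_]
  (trans (sym (ℤ.*-assoc (+ d) (+ e) n)) (cong (ℤ._* n) (sym (ℤ.pos-* d e))))

·⁺-distribˡ : ∀ d x y → d ·⁺ (x +⁺ y) ≡ d ·⁺ x +⁺ d ·⁺ y
·⁺-distribˡ d ⊤⁺    y     = refl
·⁺-distribˡ d [ m ] ⊤⁺    = refl
·⁺-distribˡ d [ m ] [ n ] = cong [_] (ℤ.*-distribˡ-+ (+ d) m n)

·⁺-mono : ∀ d → x ≤⁺ y → d ·⁺ x ≤⁺ d ·⁺ y
·⁺-mono d [ p ]≤    = [ ℤ.*-monoˡ-≤-nonNeg (+ d) p ]≤
·⁺-mono d (k ≤⊤⁺) = _ ≤⊤⁺

·⁺-injective : ∀ d .{{_ : NonZero d}} x y → d ·⁺ x ≡ d ·⁺ y → x ≡ y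
·⁺-injective d ⊤⁺    ⊤⁺    _  = refl
·⁺-injective d@(suc _) [ m ] [ n ] eq = cong [_] (ℤ.*-cancelˡ-≡ (+ d) m n ([]-injective eq))

·⁺-cancel-≤ : ∀ d .{{_ : NonZero d}} x y → d ·⁺ x ≤⁺ d ·⁺ y → x ≤⁺ y
·⁺-cancel-≤ d x ⊤⁺ _ = _ ≤⊤⁺
·⁺-cancel-≤ d@(suc _) [ m ] [ n ] [ p ]≤ = [ ℤ.*-cancelˡ-≤-pos m n (+ d) p ]≤

term-mono : ∀ d x y → [ n ] ≤⁺ x +⁺ [ + d ℤ.* μ ] → [ μ ] ≤⁺ y → [ n ] ≤⁺ x +⁺ d ·⁺ y
term-mono d ⊤⁺    y     _      _      = _ ≤⊤⁺
term-mono d [ a ] ⊤⁺    _      _      = _ ≤⊤⁺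
term-mono d [ a ] [ b ] [ p ]≤ [ r ]≤ =
  [ ℤ.≤-trans p (ℤ.+-monoʳ-≤ a (ℤ.*-monoˡ-≤-nonNeg (+ d) r)) ]≤

-- Raising `y` by one raises the sum by `d ≥ 1`. This is used with `d = qⁱ`, `x` a value of `f` and
-- `y` a value of `g`, where `+ d * μ` is the share of the minimum `μ` of `g`.
term-mono-< : ∀ d .{{_ : NonZero d}} x y →
              [ n ] ≤⁺ x +⁺ [ + d ℤ.* μ ] → [ ℤ.suc μ ] ≤⁺ y → [ ℤ.suc n ] ≤⁺ x +⁺ d ·⁺ y
term-mono-<         d         ⊤⁺    y     _      _      = _ ≤⊤⁺
term-mono-<         d         [ a ] ⊤⁺    _      _      = _ ≤⊤⁺
term-mono-< {n} {μ} d@(suc e) [ a ] [ b ] [ p ]≤ [ r ]≤ = [ begin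
  ℤ.suc n                        ≤⟨ ℤ.suc-mono p ⟩
  ℤ.suc (a ℤ.+ + d ℤ.* μ)        ≤⟨ ℤ.+-monoˡ-≤ (a ℤ.+ + d ℤ.* μ) (ℤ.+≤+ (s≤s (z≤n {e}))) ⟩
  + d ℤ.+ (a ℤ.+ + d ℤ.* μ)      ≡⟨ lemma (+ d) a μ ⟩
  a ℤ.+ + d ℤ.* ℤ.suc μ          ≤⟨ ℤ.+-monoʳ-≤ a (ℤ.*-monoˡ-≤-nonNeg (+ d) r) ⟩
  a ℤ.+ + d ℤ.* b                ∎ ]≤
  where
  open ℤ.≤-Reasoning
  lemma : ∀ d a μ → d ℤ.+ (a ℤ.+ d ℤ.* μ) ≡ a ℤ.+ d ℤ.* (1ℤ ℤ.+ μ)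
  lemma = solve-∀

-- Last minima of sequences

-- As `μ` is an integer, the sequence cannot be identically infinite. Values are integral, so
-- `suc μ ≤` expresses strictness and makes `k` the last index of the minimum.
record Dominant (α : ℕ → ℤ ⁺) (μ : ℤ) (k : ℕ) : Set where
  constructor dominant
  field
    bound    : ∀ i → [ μ ] ≤⁺ α i
    attained : α k ≡ [ μ ]
    beyond   : ∀ i → k ℕ.< i → [ ℤ.suc μ ] ≤⁺ α i

open Dominant

Dominant-cong : ∀ {α β} → α ≗ β → Dominant α μ k → Dominant β μ k
Dominant-cong eq D = dominant
  (λ i → subst ([ _ ] ≤⁺_) (eq i) (bound D i))
  (trans (sym (eq _)) (attained D))
  (λ i k<i → subst ([ _ ] ≤⁺_) (eq i) (beyond D i k<i))

Dominant-unique : ∀ {α} → Dominant α μ j → Dominant α ν k → μ ≡ ν × j ≡ k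
Dominant-unique {μ} {j} {ν} {k} {α} D E = μ≡ν , helper (ℕ.<-cmp j k)
  where
  μ≡ν : μ ≡ ν
  μ≡ν = ℤ.≤-antisym
    ([≤]-injective (subst ([ μ ] ≤⁺_) (attained E) (bound D k)))
    ([≤]-injective (subst ([ ν ] ≤⁺_) (attained D) (bound E j)))
  helper : _ → j ≡ k
  helper (tri< j<k _ _) = contradiction
    (subst₂ (λ a b → [ ℤ.suc a ] ≤⁺ b) μ≡ν (attained E) (beyond D k j<k)) suc-≰
  helper (tri≈ _ j≡k _) = j≡k
  helper (tri> _ _ k<j) = contradiction
    (subst₂ (λ a b → [ ℤ.suc a ] ≤⁺ b) (sym μ≡ν) (attained D) (beyond E j k<j)) suc-≰

-- Induction on `L`: the last minimum of the tail is compared with the first entry.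
Dominant-exists : ∀ L α → (∀ i → L ℕ.≤ i → α i ≡ ⊤⁺) →
                  (∀ i → α i ≡ ⊤⁺) ⊎ ∃₂ (Dominant α)
Dominant-exists zero    α α≡⊤ = inj₁ λ i → α≡⊤ i z≤n
Dominant-exists (suc L) α α≡⊤
  with Dominant-exists L (α ∘ suc) (λ i L≤i → α≡⊤ (suc i) (s≤s L≤i)) | α 0 in α₀
... | inj₁ tail≡⊤ | ⊤⁺ = inj₁ λ { zero → α₀ ; (suc i) → tail≡⊤ i }
... | inj₁ tail≡⊤ | [ n ] = inj₂ (n , 0 , dominant
  (λ { zero → ≤⁺-reflexive (sym α₀) ; (suc i) → subst ([ _ ] ≤⁺_) (sym (tail≡⊤ i)) (_ ≤⊤⁺) })
  α₀
  (λ { (suc i) _ → subst ([ _ ] ≤⁺_) (sym (tail≡⊤ i)) (_ ≤⊤⁺) }))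
... | inj₂ (μ , k , D) | ⊤⁺ = inj₂ (μ , suc k , dominant
  (λ { zero → subst ([ _ ] ≤⁺_) (sym α₀) (_ ≤⊤⁺) ; (suc i) → bound D i })
  (attained D)
  (λ { (suc i) (s≤s k<i) → beyond D i k<i }))
... | inj₂ (μ , k , D) | [ n ] with μ ℤ.≤? n
-- A tie goes to the tail, since the last index is wanted.
...   | yes μ≤n = inj₂ (μ , suc k , dominant
  (λ { zero → subst ([ _ ] ≤⁺_) (sym α₀) [ μ≤n ]≤ ; (suc i) → bound D i })
  (attained D)
  (λ { (suc i) (s≤s k<i) → beyond D i k<i }))
...   | no μ≰n = inj₂ (n , 0 , dominant
  (λ { zero → ≤⁺-reflexive (sym α₀) ; (suc i) → suc≤⇒≤ (above i) })
  α₀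
  (λ { (suc i) _ → above i }))
  where
  above : ∀ i → [ ℤ.suc n ] ≤⁺ α (suc i)
  above i = ≤⁺-trans [ ℤ.i<j⇒suc[i]≤j (ℤ.≰⇒> μ≰n) ]≤ (bound D i)

Dominant-exists′ : ∀ L α → (∀ i → L ℕ.≤ i → α i ≡ ⊤⁺) → α k ≡ [ n ] → ∃₂ (Dominant α)
Dominant-exists′ L α α≡⊤ αₖ≡n with Dominant-exists L α α≡⊤
... | inj₁ all⊤ = contradiction (trans (sym αₖ≡n) (all⊤ _)) λ ()
... | inj₂ D    = D

-- A lower bound that is attained is the minimum, so it agrees with the minimum found by the search,
-- which supplies the last index.
Dominant-last : ∀ L {α} → (∀ i → L ℕ.≤ i → α i ≡ ⊤⁺) → (∀ i → [ μ ] ≤⁺ α i) →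
                α k ≡ [ μ ] → ∃ (Dominant α μ)
Dominant-last {μ} {k} L {α} α≡⊤ μ≤α αₖ≡μ with ν , d , D ← Dominant-exists′ L α α≡⊤ αₖ≡μ =
  d , subst (λ ν → Dominant α ν d) (ℤ.≤-antisym
    ([≤]-injective (subst ([ ν ] ≤⁺_) αₖ≡μ (bound D k)))
    ([≤]-injective (subst ([ μ ] ≤⁺_) (attained D) (μ≤α d)))) D

Dominant-tail : ∀ {α} → [ μ ] ≤⁺ α 0 → Dominant (α ∘ suc) μ k → Dominant α μ (suc k)
Dominant-tail μ≤α₀ D = dominant
  (λ { zero → μ≤α₀ ; (suc i) → bound D i })
  (attained D)
  (λ { (suc i) (s≤s k<i) → beyond D i k<i })

-- The minimum 0 is fixed by scaling, and `d ≥ 1` keeps the later values at least 1.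
Dominant-scale : ∀ d .{{_ : NonZero d}} {α} →
                 Dominant α 0ℤ k → Dominant (λ i → d ·⁺ α i) 0ℤ k
Dominant-scale d@(suc e) {α} D = dominant
  (λ i → subst (λ a → [ a ] ≤⁺ d ·⁺ α i) (ℤ.*-zeroʳ (+ d)) (·⁺-mono d (bound D i)))
  (trans (cong (d ·⁺_) (attained D)) (cong [_] (ℤ.*-zeroʳ (+ d))))
  (λ i k<i → ≤⁺-trans [ ℤ.+≤+ (s≤s z≤n) ]≤ (·⁺-mono d (beyond D i k<i)))

Dominant-unscale : ∀ d .{{_ : NonZero d}} {α} →
                   Dominant (λ i → d ·⁺ α i) 0ℤ k → Dominant α 0ℤ k
Dominant-unscale d@(suc _) {α} D = dominant
  (λ i → ·⁺-cancel-≤ d _ _ (subst (λ a → [ a ] ≤⁺ d ·⁺ α i) (sym (ℤ.*-zeroʳ (+ d))) (bound D i)))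
  (·⁺-injective d _ _ (trans (attained D) (cong [_] (sym (ℤ.*-zeroʳ (+ d))))))
  (λ i k<i → positive (α i) (beyond D i k<i))
  where
  positive : ∀ x → [ ℤ.suc 0ℤ ] ≤⁺ d ·⁺ x → [ ℤ.suc 0ℤ ] ≤⁺ x
  positive ⊤⁺    _      = _ ≤⊤⁺
  positive [ n ] [ p ]≤ = [ ℤ.i<j⇒suc[i]≤j (ℤ.*-cancelˡ-<-nonNeg (+ d)
    (subst (ℤ._< + d ℤ.* n) (sym (ℤ.*-zeroʳ (+ d))) (ℤ.suc[i]≤j⇒i<j p))) ]≤

-- Valuations

-- The laws of a place apart from surjectivity, which is lost when `ord` is multiplied by a power of
-- q.
record Valuation (K : Field c ℓ) : Set (c ⊔ ℓ) where
  open Field K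
  field
    ord      : Carrier → ℤ ⁺
    ord-cong : ∀ {x y} → x ≈ y → ord x ≡ ord y
    ord-∞    : ∀ {x} → ord x ≡ ⊤⁺ ⇔ x ≈ 0#
    ord-*    : ∀ x y → ord (x * y) ≡ ord x +⁺ ord y
    ord-+    : ∀ x y → ord x ⊓⁺ ord y ≤⁺ ord (x + y)

placeValuation : {K : Field c ℓ} → Place K → Valuation K
placeValuation v = record { Place v }

scale : (d : ℕ) .{{_ : NonZero d}} {K : Field c ℓ} → Valuation K → Valuation K
scale d {K} V = record
  { ord      = λ x → d ·⁺ ord x
  ; ord-cong = λ x≈y → cong (d ·⁺_) (ord-cong x≈y)
  ; ord-∞    = λ {x} → mk⇔
      (λ eq → Equivalence.to ord-∞ (·⁺-injective d (ord x) ⊤⁺ eq))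
      (λ x≈0 → cong (d ·⁺_) (Equivalence.from ord-∞ x≈0))
  ; ord-*    = λ x y → trans (cong (d ·⁺_) (ord-* x y)) (·⁺-distribˡ d (ord x) (ord y))
  ; ord-+    = λ x y → ≤⁺-trans (·⁺-⊓⁺ (ord x) (ord y)) (·⁺-mono d (ord-+ x y))
  }
  where
  open Valuation V
  ·⁺-⊓⁺ : ∀ x y → (d ·⁺ x) ⊓⁺ (d ·⁺ y) ≤⁺ d ·⁺ (x ⊓⁺ y)
  ·⁺-⊓⁺ x y with ⊓-sel x y
  ... | inj₁ eq = subst (λ z → (d ·⁺ x) ⊓⁺ (d ·⁺ y) ≤⁺ d ·⁺ z) (sym eq) (x⊓y≤x (d ·⁺ x) (d ·⁺ y))
  ... | inj₂ eq = subst (λ z → (d ·⁺ x) ⊓⁺ (d ·⁺ y) ≤⁺ d ·⁺ z) (sym eq) (x⊓y≤y (d ·⁺ x) (d ·⁺ y))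

module ValuationProperties {c ℓ} {K : Field c ℓ} (V : Valuation K) where
  open Field K hiding (refl; sym; trans)
  private module K = Field K
  open RingProperties ring using (-1*x≈-x; -‿involutive)
  open RawSemiringDefinitions (RawRing.rawSemiring rawRing) using (_^_)
  open Valuation V

  ord-0 : ord 0# ≡ ⊤⁺
  ord-0 = Equivalence.from ord-∞ K.refl

  ord≢⊤⇒≉0 : ∀ {x} → ord x ≡ [ n ] → ¬ (x ≈ 0#)
  ord≢⊤⇒≉0 ord≡n x≈0 = contradiction (trans (sym ord≡n) (Equivalence.from ord-∞ x≈0)) λ ()

  ≉0⇒ord-finite : ∀ {x} → ¬ (x ≈ 0#) → ∃ λ n → ord x ≡ [ n ]
  ≉0⇒ord-finite {x} x≉0 with ord x in eq
  ... | ⊤⁺    = contradiction (Equivalence.to ord-∞ eq) x≉0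
  ... | [ n ] = n , refl

  ord-1 : ord 1# ≡ [ 0ℤ ]
  ord-1 with ord 1# in eq | trans (sym (ord-* 1# 1#)) (ord-cong (*-identityˡ 1#))
  ... | ⊤⁺    | _ = contradiction (K.sym (Equivalence.to ord-∞ eq)) 0≉1
  ... | [ n ] | idem = cong [_] (x+x≈x⇒x≈0 n ([]-injective idem))

  -- Since (-1)² = 1 and ℤ has no 2-torsion, -1 has value 0.
  ord-neg : ∀ x → ord (- x) ≡ ord x
  ord-neg x = trans (ord-cong (K.sym (-1*x≈-x x))) (trans (ord-* (- 1#) x)
    (trans (cong (_+⁺ ord x) ord[-1]) (+⁺-identityˡ (ord x))))
    where
    torsion : ∀ y → y +⁺ y ≡ [ 0ℤ ] → y ≡ [ 0ℤ ]
    torsion [ n ] eq = cong [_] (ℤ.*-cancelˡ-≡ (+ 2) n 0ℤ (trans (lemma n) ([]-injective eq)))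
      where
      lemma : ∀ n → + 2 ℤ.* n ≡ n ℤ.+ n
      lemma = solve-∀
    ord[-1] : ord (- 1#) ≡ [ 0ℤ ]
    ord[-1] = torsion (ord (- 1#)) (trans (sym (ord-* (- 1#) (- 1#)))
      (trans (ord-cong (K.trans (-1*x≈-x (- 1#)) (-‿involutive 1#))) ord-1))

  ord-+-glb : ∀ {z} x y → z ≤⁺ ord x → z ≤⁺ ord y → z ≤⁺ ord (x + y)
  ord-+-glb x y z≤x z≤y = ≤⁺-trans (⊓-glb z≤x z≤y) (ord-+ x y)

  -- If `x + y` had a value larger than `n`, then so would `x = (x + y) − y`.
  ord-+-dominant : ∀ x y → ord x ≡ [ n ] → [ ℤ.suc n ] ≤⁺ ord y → ord (x + y) ≡ [ n ]
  ord-+-dominant {n} x y x≡n n<y =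
    pinch (ord (x + y)) refl (ord-+-glb x y (≤⁺-reflexive (sym x≡n)) (suc≤⇒≤ n<y))
    where
    x+y-y≈x : (x + y) + - y ≈ x
    x+y-y≈x = K.trans (+-assoc x y (- y)) (K.trans (+-congˡ (-‿inverseʳ y)) (+-identityʳ x))
    large : [ ℤ.suc n ] ≤⁺ ord (x + y) → [ ℤ.suc n ] ≤⁺ [ n ]
    large n<x+y = subst ([ ℤ.suc n ] ≤⁺_) (trans (ord-cong x+y-y≈x) x≡n)
      (ord-+-glb (x + y) (- y) n<x+y (subst ([ ℤ.suc n ] ≤⁺_) (sym (ord-neg y)) n<y))
    pinch : ∀ z → ord (x + y) ≡ z → [ n ] ≤⁺ z → z ≡ [ n ]
    pinch ⊤⁺    eq _ = contradiction (large (subst ([ _ ] ≤⁺_) (sym eq) (_ ≤⊤⁺))) suc-≰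
    pinch [ m ] eq [ n≤m ]≤ with n ℤ.<? m
    ... | yes n<m = contradiction (large (subst ([ _ ] ≤⁺_) (sym eq) [ ℤ.i<j⇒suc[i]≤j n<m ]≤)) suc-≰
    ... | no  n≮m = cong [_] (ℤ.≤-antisym (ℤ.≮⇒≥ n≮m) n≤m)

  ord-^ : ∀ x n .{{_ : NonZero n}} → ord (x ^ n) ≡ n ·⁺ ord x
  ord-^ x (suc zero) = trans (ord-cong (*-identityʳ x)) (sym (1·⁺ (ord x)))
  ord-^ x (suc n@(suc _)) = trans (ord-* x (x ^ n)) (trans (cong (ord x +⁺_) (ord-^ x n)) (lemma (ord x)))
    where
    lemma : ∀ y → y +⁺ n ·⁺ y ≡ suc n ·⁺ y
    lemma ⊤⁺    = refl
    lemma [ m ] = cong [_] (sym (ℤ.suc-* (+ n) m))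

  ord-inv : ∀ {x} (x≉0 : ¬ (x ≈ 0#)) → ord x ≡ [ n ] → ord (inv x≉0) ≡ [ ℤ.- n ]
  ord-inv {n} {x} x≉0 x≡n = lemma (ord (inv x≉0)) (trans (cong (ord (inv x≉0) +⁺_) (sym x≡n))
    (trans (sym (ord-* (inv x≉0) x)) (trans (ord-cong (proj₁ (proj₂ (invertible x≉0)))) ord-1)))
    where
    lemma : ∀ y → y +⁺ [ n ] ≡ [ 0ℤ ] → y ≡ [ ℤ.- n ]
    lemma [ m ] eq = cong [_] (trans (sym (solved m n)) (trans (cong (ℤ._- n) ([]-injective eq)) (ℤ.+-identityˡ _)))
      where
      solved : ∀ m n → m ℤ.+ n ℤ.- n ≡ m
      solved = solve-∀

-- Gauss values of twisted polynomials

module SkewPolynomialProperties {c ℓ} (R : CommutativeRing c ℓ)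
                                (σ : CommutativeRing.Carrier R → CommutativeRing.Carrier R) where
  private
    module R = CommutativeRing R
    module P = SkewPolynomial R σ
  open P using (coeff)

  coeff-+ : ∀ f g i → coeff (f P.+ g) i R.≈ coeff f i R.+ coeff g i
  coeff-+ []      g       i       = R.sym (R.+-identityˡ _)
  coeff-+ (x ∷ f) []      zero    = R.sym (R.+-identityʳ x)
  coeff-+ (x ∷ f) []      (suc i) = R.sym (R.+-identityʳ _)
  coeff-+ (x ∷ f) (y ∷ g) zero    = R.refl
  coeff-+ (x ∷ f) (y ∷ g) (suc i) = coeff-+ f g i

  coeff-map : ∀ {h} → h R.0# R.≈ R.0# → ∀ f i → coeff (map h f) i R.≈ h (coeff f i)
  coeff-map h0≈0 []      i       = R.sym h0≈0
  coeff-map h0≈0 (x ∷ f) zero    = R.refl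
  coeff-map h0≈0 (x ∷ f) (suc i) = coeff-map h0≈0 f i

module TwistedValuation {q : ℕ} .{{_ : NonZero q}} {c ℓ} {K : Field c ℓ} (V : Valuation K) where
  private
    module K = Field K
    module P = TwistedPolynomial q K
  open P using (Poly; coeff)
  open RawSemiringDefinitions (RawRing.rawSemiring K.rawRing) using (_^_)
  open Valuation V
  open ValuationProperties V

  σ : K.Carrier → K.Carrier
  σ x = x ^ q

  open SkewPolynomialProperties K.commutativeRing σ using (coeff-+)

  ord-coeff-scale : ∀ x g i → ord (coeff (map (x K.*_) g) i) ≡ ord x +⁺ ord (coeff g i)
  ord-coeff-scale x []      i       =
    trans ord-0 (trans (sym (+⁺-zeroʳ (ord x))) (cong (ord x +⁺_) (sym ord-0)))
  ord-coeff-scale x (y ∷ g) zero    = ord-* x y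
  ord-coeff-scale x (y ∷ g) (suc i) = ord-coeff-scale x g i

  ord-coeff-σ : ∀ g i → ord (coeff (map σ g) i) ≡ q ·⁺ ord (coeff g i)
  ord-coeff-σ []      i       = trans ord-0 (cong (q ·⁺_) (sym ord-0))
  ord-coeff-σ (y ∷ g) zero    = ord-^ y q
  ord-coeff-σ (y ∷ g) (suc i) = ord-coeff-σ g i

  ord-beyond-length : ∀ f i → List.length f ℕ.≤ i → ord (coeff f i) ≡ ⊤⁺
  ord-beyond-length []      i       _         = ord-0
  ord-beyond-length (x ∷ f) (suc i) (s≤s ≤i) = ord-beyond-length f i ≤i

  -- The value of the monomial fᵢ τⁱ gⱼ τʲ = fᵢ σⁱ(gⱼ) τⁱ⁺ʲ.
  ord-monomial : Poly → Poly → ℕ → ℕ → ℤ ⁺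
  ord-monomial f g i j = ord (coeff f i) +⁺ (q ℕ.^ i) ·⁺ ord (coeff g j)

  ord-monomial-zero : ∀ x f g j →
    ord-monomial (x ∷ f) g 0 j ≡ ord (coeff (map (x K.*_) g) j)
  ord-monomial-zero x f g j =
    trans (cong (ord x +⁺_) (1·⁺ _)) (sym (ord-coeff-scale x g j))

  -- Follows the recursion (x + f τ) g = x g + f σ(g) τ of the product: moving one τ past `g`
  -- multiplies its values by q.
  ord-monomial-suc : ∀ x f g i j →
    ord-monomial (x ∷ f) g (suc i) j ≡ ord-monomial f (map σ g) i j
  ord-monomial-suc x f g i j = cong (ord (coeff f i) +⁺_) (trans
    (trans (cong (_·⁺ ord (coeff g j)) (ℕ.*-comm q (q ℕ.^ i)))
      (sym (·⁺-assoc (q ℕ.^ i) q (ord (coeff g j)))))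
    (cong ((q ℕ.^ i) ·⁺_) (sym (ord-coeff-σ g j))))

  -- The coefficient of τˡ is the sum of the fᵢ σⁱ(gⱼ) with i + j = l. Recursion on `f` splits off
  -- the summand with i = 0 and replaces `g` by σ(g) in the others.
  ord-product-≥ : ∀ f g l → (∀ i j → i ℕ.+ j ≡ l → z ≤⁺ ord-monomial f g i j) →
                  z ≤⁺ ord (coeff (f P.* g) l)
  ord-product-≥ []      g l h = subst (_ ≤⁺_) (sym ord-0) (_ ≤⊤⁺)
  ord-product-≥ {z} (x ∷ f) g l h =
    subst (z ≤⁺_) (ord-cong (K.sym (coeff-+ (map (x K.*_) g) (K.0# ∷ (f P.* map σ g)) l)))
      (ord-+-glb _ _ (subst (z ≤⁺_) (ord-monomial-zero x f g l) (h 0 l refl)) (rest l h))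
    where
    rest : ∀ l → (∀ i j → i ℕ.+ j ≡ l → z ≤⁺ ord-monomial (x ∷ f) g i j) →
           z ≤⁺ ord (coeff (K.0# ∷ (f P.* map σ g)) l)
    rest zero    h = subst (z ≤⁺_) (sym ord-0) (_ ≤⊤⁺)
    rest (suc l) h = ord-product-≥ f (map σ g) l λ i j i+j≡l →
      subst (z ≤⁺_) (ord-monomial-suc x f g i j) (h (suc i) j (cong suc i+j≡l))

  -- A single monomial of least value determines the value of the sum. The recursion moves it to i =
  -- 0, where it lies in the first summand of the product.
  ord-product-≡ : ∀ f g i j → ord-monomial f g i j ≡ [ n ] →
    (∀ i′ j′ → i′ ℕ.+ j′ ≡ i ℕ.+ j → i′ ≢ i → [ ℤ.suc n ] ≤⁺ ord-monomial f g i′ j′) →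
    ord (coeff (f P.* g) (i ℕ.+ j)) ≡ [ n ]
  ord-product-≡ [] g i j eq _ =
    contradiction (trans (sym eq) (cong (_+⁺ (q ℕ.^ i) ·⁺ ord (coeff g j)) ord-0)) λ ()
  ord-product-≡ {n} (x ∷ f) g zero j eq h =
    trans (ord-cong (coeff-+ (map (x K.*_) g) _ j))
      (ord-+-dominant _ _ (trans (sym (ord-monomial-zero x f g j)) eq) (rest j h))
    where
    rest : ∀ l → (∀ i′ j′ → i′ ℕ.+ j′ ≡ l → i′ ≢ 0 → [ ℤ.suc n ] ≤⁺ ord-monomial (x ∷ f) g i′ j′) →
           [ ℤ.suc n ] ≤⁺ ord (coeff (K.0# ∷ (f P.* map σ g)) l)
    rest zero    h = subst (_ ≤⁺_) (sym ord-0) (_ ≤⊤⁺)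
    rest (suc l) h = ord-product-≥ f (map σ g) l λ i j i+j≡l →
      subst (_ ≤⁺_) (ord-monomial-suc x f g i j) (h (suc i) j (cong suc i+j≡l) λ ())
  ord-product-≡ {n} (x ∷ f) g (suc i) j eq h =
    -- The least monomial lies in the second summand here, so the summands are swapped.
    trans (ord-cong (K.trans (coeff-+ (map (x K.*_) g) _ (suc i ℕ.+ j)) (K.+-comm _ _)))
      (ord-+-dominant _ _
        (ord-product-≡ f (map σ g) i j (trans (sym (ord-monomial-suc x f g i j)) eq)
          λ i′ j′ sum≡ i′≢i → subst (_ ≤⁺_) (ord-monomial-suc x f g i′ j′)
            (h (suc i′) j′ (cong suc sum≡) (i′≢i ∘ ℕ.suc-injective)))
        (subst (_ ≤⁺_) (ord-monomial-zero x f g (suc i ℕ.+ j)) (h 0 _ refl λ ())))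

  -- The values of the coefficients of y⁻¹ f x, where ord x = a and ord y = b;
  -- no such x and y are required to exist.
  twist : ℤ → ℤ → Poly → ℕ → ℤ ⁺
  twist a b f i = ord (coeff f i) +⁺ [ + (q ℕ.^ i) ℤ.* a ℤ.- b ]

  twist-⊤ : ∀ a b f i → List.length f ℕ.≤ i → twist a b f i ≡ ⊤⁺
  twist-⊤ a b f i ≤i = cong (_+⁺ [ + (q ℕ.^ i) ℤ.* a ℤ.- b ]) (ord-beyond-length f i ≤i)

  twist-cong : ∀ a b f g → (∀ i → coeff f i K.≈ coeff g i) → twist a b f ≗ twist a b g
  twist-cong a b f g f≈g i = cong (_+⁺ [ + (q ℕ.^ i) ℤ.* a ℤ.- b ]) (ord-cong (f≈g i))

  module _ (a b c : ℤ) where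
    -- On values, the identity y⁻¹ (f g) z = (y⁻¹ f x)(x⁻¹ g z) with x, y, z of values `a`, `b`,
    -- `c`.
    twist-monomial : ∀ f g i j →
      ord-monomial f g i j +⁺ [ + (q ℕ.^ (i ℕ.+ j)) ℤ.* c ℤ.- b ] ≡
      twist a b f i +⁺ (q ℕ.^ i) ·⁺ twist c a g j
    twist-monomial f g i j with ord (coeff f i) | ord (coeff g j)
    ... | ⊤⁺    | y     = refl
    ... | [ x ] | ⊤⁺    = refl
    ... | [ x ] | [ y ] = cong [_] (trans
      (cong (λ e → x ℤ.+ + (q ℕ.^ i) ℤ.* y ℤ.+ (e ℤ.* c ℤ.- b))
        (trans (cong +_ (ℕ.^-distribˡ-+-* q i j)) (ℤ.pos-* (q ℕ.^ i) (q ℕ.^ j))))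
      (lemma x y (+ (q ℕ.^ i)) (+ (q ℕ.^ j)) a b c))
      where
      lemma : ∀ x y p r a b c → x ℤ.+ p ℤ.* y ℤ.+ (p ℤ.* r ℤ.* c ℤ.- b) ≡
                                x ℤ.+ (p ℤ.* a ℤ.- b) ℤ.+ p ℤ.* (y ℤ.+ (r ℤ.* c ℤ.- a))
      lemma = solve-∀

    -- A Gauss lemma. Moving the minimum `μ` of `g` past τⁱ turns it into qⁱ μ, hence the weights in
    -- the hypothesis on `f`. A pair of indices with the same sum as the two last indices but
    -- different from them, or with a larger sum, exceeds one of the last indices, so its monomial
    -- has a value above `m`.
    Dominant-* : ∀ f g → Dominant (twist c a g) μ j →
                 Dominant (λ i → twist a b f i +⁺ [ + (q ℕ.^ i) ℤ.* μ ]) m i →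
                 Dominant (twist c b (f P.* g)) m (i ℕ.+ j)
    Dominant-* {μ} {j₀} {m} {i₀} f g G F = dominant
      (λ l → product-≥ l λ i j _ → weak i j)
      (product-≡ (trans (twist-monomial f g i₀ j₀)
        (trans (cong (λ y → twist a b f i₀ +⁺ (q ℕ.^ i₀) ·⁺ y) (attained G)) (attained F)))
        λ i j sum≡ i≢i₀ → strict i j (off-corner i j sum≡ i≢i₀))
      (λ l i₀+j₀<l → product-≥ l λ i j sum≡ → strict i j (far i j (subst (_ ℕ.<_) (sym sum≡) i₀+j₀<l)))
      where
      value : ℕ → ℕ → ℤ ⁺
      value i j = twist a b f i +⁺ (q ℕ.^ i) ·⁺ twist c a g j

      exponent : ℕ → ℤ
      exponent l = + (q ℕ.^ l) ℤ.* c ℤ.- b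

      weak : ∀ i j → [ m ] ≤⁺ value i j
      weak i j = term-mono (q ℕ.^ i) _ _ (bound F i) (bound G j)

      strict : ∀ i j → i₀ ℕ.< i ⊎ j₀ ℕ.< j → [ ℤ.suc m ] ≤⁺ value i j
      strict i j (inj₁ i₀<i) = term-mono (q ℕ.^ i) _ _ (beyond F i i₀<i) (bound G j)
      strict i j (inj₂ j₀<j) = term-mono-< (q ℕ.^ i) {{ℕ.m^n≢0 q i}} _ _ (bound F i) (beyond G j j₀<j)

      far : ∀ i j → i₀ ℕ.+ j₀ ℕ.< i ℕ.+ j → i₀ ℕ.< i ⊎ j₀ ℕ.< j
      far i j lt with i₀ ℕ.<? i | j₀ ℕ.<? j
      ... | yes p | _     = inj₁ p
      ... | no _  | yes p = inj₂ p
      ... | no p  | no r  = contradiction lt (ℕ.≤⇒≯ (ℕ.+-mono-≤ (ℕ.≮⇒≥ p) (ℕ.≮⇒≥ r)))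

      off-corner : ∀ i j → i ℕ.+ j ≡ i₀ ℕ.+ j₀ → i ≢ i₀ → i₀ ℕ.< i ⊎ j₀ ℕ.< j
      off-corner i j sum≡ i≢i₀ with ℕ.<-cmp i i₀
      ... | tri< i<i₀ _ _ = inj₂ (ℕ.≰⇒> λ j≤j₀ → ℕ.<⇒≢ (ℕ.+-mono-<-≤ i<i₀ j≤j₀) sum≡)
      ... | tri≈ _ i≡i₀ _ = contradiction i≡i₀ i≢i₀
      ... | tri> _ _ i₀<i = inj₁ i₀<i

      lower : ∀ {n} i j l → i ℕ.+ j ≡ l → [ n ] ≤⁺ value i j → [ n ℤ.- exponent l ] ≤⁺ ord-monomial f g i j
      lower i j l refl n≤ = +⁺-unshift (subst ([ _ ] ≤⁺_) (sym (twist-monomial f g i j)) n≤)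

      product-≥ : ∀ {n} l → (∀ i j → i ℕ.+ j ≡ l → [ n ] ≤⁺ value i j) →
                  [ n ] ≤⁺ twist c b (f P.* g) l
      product-≥ l h = +⁺-shift (ord-product-≥ f g l λ i j sum≡ → lower i j l sum≡ (h i j sum≡))

      product-≡ : ord-monomial f g i₀ j₀ +⁺ [ exponent (i₀ ℕ.+ j₀) ] ≡ [ m ] →
                  (∀ i j → i ℕ.+ j ≡ i₀ ℕ.+ j₀ → i ≢ i₀ → [ ℤ.suc m ] ≤⁺ value i j) →
                  twist c b (f P.* g) (i₀ ℕ.+ j₀) ≡ [ m ]
      product-≡ eq h with ord-monomial f g i₀ j₀ in corner
      ... | [ n ] = trans (cong (_+⁺ [ exponent (i₀ ℕ.+ j₀) ]) (ord-product-≡ f g i₀ j₀ corner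
              λ i j sum≡ i≢i₀ → subst (λ k → [ k ] ≤⁺ _)
                (trans (cong (λ m → ℤ.suc m ℤ.- exponent (i₀ ℕ.+ j₀)) (sym ([]-injective eq)))
                  (lemma n (exponent (i₀ ℕ.+ j₀))))
                (lower i j _ sum≡ (h i j sum≡ i≢i₀)))) eq
        where
        lemma : ∀ n t → 1ℤ ℤ.+ (n ℤ.+ t) ℤ.- t ≡ 1ℤ ℤ.+ n
        lemma = solve-∀

  twist-finite : ∀ a b f → ord (coeff f i) ≡ [ n ] → ∃ λ m → twist a b f i ≡ [ m ]
  twist-finite {i} a b f fᵢ≡n = _ , cong (_+⁺ [ + (q ℕ.^ i) ℤ.* a ℤ.- b ]) fᵢ≡n

  twist-≡⊤ : ∀ a b f → twist a b f i ≡ ⊤⁺ → coeff f i K.≈ K.0#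
  twist-≡⊤ {i} a b f eq with ord (coeff f i) in fᵢ
  ... | ⊤⁺ = Equivalence.to ord-∞ fᵢ

  -- Dividing by an element of value `b` lowers every value by `b`; this makes the minimum of `f`
  -- equal to 0.
  Dominant-shift : ∀ a {b d} f → Dominant (twist a 0ℤ f) b d → Dominant (twist a b f) 0ℤ d
  Dominant-shift a {b} {d} f F = dominant
    (λ i → subst ([ 0ℤ ] ≤⁺_) (sym (shift i))
      (+⁺-shift (subst (λ n → [ n ] ≤⁺ twist a 0ℤ f i) (lemma₁ b) (bound F i))))
    (trans (shift d) (trans (cong (_+⁺ [ ℤ.- b ]) (attained F)) (cong [_] (ℤ.+-inverseʳ b))))
    (λ i d<i → subst ([ 1ℤ ] ≤⁺_) (sym (shift i))
      (+⁺-shift (subst (λ n → [ n ] ≤⁺ twist a 0ℤ f i) (lemma₂ b) (beyond F i d<i))))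
    where
    lemma₁ : ∀ b → b ≡ 0ℤ ℤ.- (ℤ.- b)
    lemma₁ = solve-∀
    lemma₂ : ∀ b → 1ℤ ℤ.+ b ≡ 1ℤ ℤ.- (ℤ.- b)
    lemma₂ = solve-∀
    shift : ∀ i → twist a b f i ≡ twist a 0ℤ f i +⁺ [ ℤ.- b ]
    shift i with ord (coeff f i)
    ... | ⊤⁺    = refl
    ... | [ x ] = cong [_] (solved x (+ (q ℕ.^ i) ℤ.* a) b)
      where
      solved : ∀ x y b → x ℤ.+ (y ℤ.- b) ≡ x ℤ.+ (y ℤ.- 0ℤ) ℤ.+ ℤ.- b
      solved = solve-∀

  private
    -- The form in which `Dominant-*` takes its left factor when the right one has minimum 0.
    Dominant-+0 : ∀ {α} → Dominant α m k → Dominant (λ i → α i +⁺ [ + (q ℕ.^ i) ℤ.* 0ℤ ]) m k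
    Dominant-+0 {α = α} = Dominant-cong λ i →
      sym (trans (cong (λ e → α i +⁺ [ e ]) (ℤ.*-zeroʳ (+ (q ℕ.^ i)))) (+⁺-identityʳ (α i)))

  module _ {f g h : Poly} (fg≈hf : ∀ i → coeff (f P.* g) i K.≈ coeff (h P.* f) i)
           {a b : ℤ} {d : ℕ} (F : Dominant (twist a b f) 0ℤ d) where

    private
      positive : ∀ i → ℤ.Positive (+ (q ℕ.^ i))
      positive i = ℤ.positive (ℤ.+<+ (ℕ.m^n>0 q i))

      -- At `d` the value of `f` is 0, so the bound in `F′` gives q^d μ ≥ 0. At `e` the weighted
      -- value is 0 and that of `f` is at least 0, so q^e μ ≤ 0.
      μ≡0 : ∀ {e} μ → Dominant (λ i → twist a b f i +⁺ [ + (q ℕ.^ i) ℤ.* μ ]) 0ℤ e → μ ≡ 0ℤ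
      μ≡0 {e} μ F′ = ℤ.≤-antisym
        (ℤ.*-cancelˡ-≤-pos μ 0ℤ (+ (q ℕ.^ e)) {{positive e}}
          (subst (+ (q ℕ.^ e) ℤ.* μ ℤ.≤_) (sym (ℤ.*-zeroʳ (+ (q ℕ.^ e))))
            (nonpositive (twist a b f e) (bound F e) (attained F′))))
        (ℤ.*-cancelˡ-≤-pos 0ℤ μ (+ (q ℕ.^ d)) {{positive d}}
          (subst (ℤ._≤ + (q ℕ.^ d) ℤ.* μ) (sym (ℤ.*-zeroʳ (+ (q ℕ.^ d))))
            ([≤]-injective (subst ([ 0ℤ ] ≤⁺_) (trans (cong (_+⁺ [ + (q ℕ.^ d) ℤ.* μ ]) (attained F))
              (+⁺-identityˡ _)) (bound F′ d)))))
        where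
        nonpositive : ∀ y {t} → [ 0ℤ ] ≤⁺ y → y +⁺ [ t ] ≡ [ 0ℤ ] → t ℤ.≤ 0ℤ
        nonpositive [ y ] {t} [ 0≤y ]≤ eq =
          subst₂ ℤ._≤_ (ℤ.+-identityˡ t) ([]-injective eq) (ℤ.+-monoˡ-≤ t 0≤y)

      product-unique : Dominant (twist a b (f P.* g)) μ i → Dominant (twist a b (h P.* f)) ν j →
                       μ ≡ ν × i ≡ j
      product-unique D E = Dominant-unique (Dominant-cong (twist-cong a b (f P.* g) (h P.* f) fg≈hf) D) E

    -- The product f g has minimum 0 at last index d + k, and h f has the minimum of `h` at last
    -- index j + d. The products agree, so `h` has minimum 0 and j = k. The finite value of one
    -- coefficient ensures that `h` has a minimum.
    Dominant-target : ord (coeff h i) ≡ [ n ] →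
                      Dominant (twist a a g) 0ℤ k → Dominant (twist b b h) 0ℤ k
    Dominant-target {k = k} hᵢ≡n G
      with _ , eq ← twist-finite b b h hᵢ≡n
      with μ , j , H ← Dominant-exists′ (List.length h) (twist b b h) (twist-⊤ b b h) eq
      with 0≡μ , d+k≡j+d ← product-unique (Dominant-* a b a f g G (Dominant-+0 F))
             (Dominant-* b b a h f F (Dominant-+0 H))
      = subst₂ (Dominant (twist b b h)) (sym 0≡μ)
          (ℕ.+-cancelʳ-≡ d j k (trans (sym d+k≡j+d) (ℕ.+-comm d k))) H

    -- The unknown minimum `μ` of `g` enters f g through the weights qⁱ μ on `f`. Comparison with h
    -- f shows that the weighted minimum is 0, which forces μ = 0; then the last index of the
    -- weighted sequence is `d`, and it cancels.
    Dominant-source : ord (coeff g i) ≡ [ n ] →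
                      Dominant (twist b b h) 0ℤ k → Dominant (twist a a g) 0ℤ k
    Dominant-source {k = k} gᵢ≡n H
      with _ , eq ← twist-finite a a g gᵢ≡n
      with μ , j , G ← Dominant-exists′ (List.length g) (twist a a g) (twist-⊤ a a g) eq
      with m , e , F′ ← Dominant-exists′ (List.length f) (λ i → twist a b f i +⁺ [ + (q ℕ.^ i) ℤ.* μ ])
             (λ i ≤i → cong (_+⁺ [ + (q ℕ.^ i) ℤ.* μ ]) (twist-⊤ a b f i ≤i))
             (cong (_+⁺ [ + (q ℕ.^ d) ℤ.* μ ]) (attained F))
      with refl , e+j≡k+d ← product-unique (Dominant-* a b a f g G F′)
             (Dominant-* b b a h f F (Dominant-+0 H))
      with refl ← μ≡0 μ F′
      with _ , refl ← Dominant-unique F′ (Dominant-+0 F)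
      = subst (Dominant (twist a a g) 0ℤ) (ℕ.+-cancelˡ-≡ d j k (trans e+j≡k+d (ℕ.+-comm k d))) G

  coeff-C-* : ∀ y f i → coeff (P.C y P.* f) i K.≈ coeff (map (y K.*_) f) i
  coeff-C-* y f i = K.trans (coeff-+ (map (y K.*_) f) _ i) (K.trans (K.+-congˡ (zeros i)) (K.+-identityʳ _))
    where
    zeros : ∀ i → coeff (K.0# ∷ []) i K.≈ K.0#
    zeros zero    = K.refl
    zeros (suc i) = K.refl

  ord-coeff-*-C : ∀ f x i → ord (coeff (f P.* P.C x) i) ≡ ord (coeff f i) +⁺ (q ℕ.^ i) ·⁺ ord x
  ord-coeff-*-C []      x i       = trans ord-0 (cong (_+⁺ (q ℕ.^ i) ·⁺ ord x) (sym ord-0))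
  ord-coeff-*-C (y ∷ f) x zero    = trans (ord-cong (K.+-identityʳ _))
    (trans (ord-* y x) (cong (ord y +⁺_) (sym (1·⁺ (ord x)))))
  ord-coeff-*-C (y ∷ f) x (suc i) = trans (ord-coeff-*-C f (σ x) i) (cong (ord (coeff f i) +⁺_)
    (trans (cong ((q ℕ.^ i) ·⁺_) (ord-^ x q)) (trans (·⁺-assoc (q ℕ.^ i) q (ord x))
      (cong (_·⁺ ord x) (ℕ.*-comm (q ℕ.^ i) q)))))

  -- By τⁱ x = x^(qⁱ) τⁱ the coefficients of x⁻¹ f x are x⁻¹ fᵢ x^(qⁱ). This links the formal
  -- `twist` to the conjugates in the definition of stable reduction.
  ord-conjugate : ∀ {x} (x≉0 : ¬ (x K.≈ K.0#)) → ord x ≡ [ n ] → ∀ f i →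
                  ord (coeff (P.C (K.inv x≉0) P.* f P.* P.C x) i) ≡ twist n n f i
  ord-conjugate {n} {x} x≉0 x≡n f i = trans (ord-coeff-*-C (P.C (K.inv x≉0) P.* f) x i)
    (trans (cong₂ (λ y z → y +⁺ (q ℕ.^ i) ·⁺ z)
        (trans (ord-cong (coeff-C-* (K.inv x≉0) f i))
          (trans (ord-coeff-scale _ f i) (cong (_+⁺ ord (coeff f i)) (ord-inv x≉0 x≡n))))
        x≡n)
      (lemma (ord (coeff f i)) (+ (q ℕ.^ i))))
    where
    lemma : ∀ y r → [ ℤ.- n ] +⁺ y +⁺ [ r ℤ.* n ] ≡ y +⁺ [ r ℤ.* n ℤ.- n ]
    lemma ⊤⁺    r = refl
    lemma [ y ] r = cong [_] (solved n y r)
      where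
      solved : ∀ n y r → ℤ.- n ℤ.+ y ℤ.+ r ℤ.* n ≡ y ℤ.+ (r ℤ.* n ℤ.- n)
      solved = solve-∀

  coeff₀-conjugate : ∀ {x} (x≉0 : ¬ (x K.≈ K.0#)) f →
                     coeff (P.C (K.inv x≉0) P.* f P.* P.C x) 0 K.≈ coeff f 0
  coeff₀-conjugate {x} x≉0 [] = K.+-identityʳ _ ⟨≈⟩ K.zeroˡ x
    where
    infixr 1 _⟨≈⟩_
    _⟨≈⟩_ = K.trans
  coeff₀-conjugate {x} x≉0 (y ∷ f) = begin
    (x⁻¹ K.* y K.+ K.0#) K.* x K.+ K.0#  ≈⟨ K.+-identityʳ _ ⟩
    (x⁻¹ K.* y K.+ K.0#) K.* x           ≈⟨ K.*-congʳ (K.+-identityʳ _) ⟩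
    (x⁻¹ K.* y) K.* x                    ≈⟨ K.*-congʳ (K.*-comm x⁻¹ y) ⟩
    (y K.* x⁻¹) K.* x                    ≈⟨ K.*-assoc y x⁻¹ x ⟩
    y K.* (x⁻¹ K.* x)                    ≈⟨ K.*-congˡ (proj₁ (proj₂ (K.invertible x≉0))) ⟩
    y K.* K.1#                           ≈⟨ K.*-identityʳ y ⟩
    y                                    ∎
    where
    open SetoidReasoning K.setoid
    x⁻¹ = K.inv x≉0

-- Minima of vectors and divisibility by powers of q

minimum⁺-glb : ∀ {r} (g : Vector (ℤ ⁺) r) → (∀ i → z ≤⁺ g i) → z ≤⁺ minimum⁺ g
minimum⁺-glb {r = zero}  g z≤g = _ ≤⊤⁺
minimum⁺-glb {r = suc r} g z≤g = ⊓-glb (z≤g zero) (minimum⁺-glb (g ∘ suc) (z≤g ∘ suc))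

minimum⁺-≤ : ∀ {r} (g : Vector (ℤ ⁺) r) i → minimum⁺ g ≤⁺ g i
minimum⁺-≤ g zero    = x⊓y≤x (g zero) (minimum⁺ (g ∘ suc))
minimum⁺-≤ g (suc i) = ≤⁺-trans (x⊓y≤y (g zero) (minimum⁺ (g ∘ suc))) (minimum⁺-≤ (g ∘ suc) i)

-- The relation reads a = q^L z + q^(k+1) a. If `a` is known to be a multiple of q^L, substituting
-- this on the right of the relation for L + 1 gains one more factor q, because the exponent k + 1
-- is positive.
divisible-by-power : ∀ q L z k a → + (q ℕ.^ L) ℤ.* z ℤ.+ (+ (q ℕ.^ suc k) ℤ.* a ℤ.- a) ≡ 0ℤ →
       ∃ λ n → a ≡ + (q ℕ.^ L) ℤ.* n
divisible-by-power q zero    z k a eq = a , sym (ℤ.*-identityˡ a)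
divisible-by-power q (suc L) z k a eq = z ℤ.+ + (q ℕ.^ k) ℤ.* b , (begin
    a
      ≡⟨ lemma₂ (+ (q ℕ.^ suc L) ℤ.* z) (+ (q ℕ.^ suc k) ℤ.* a) a ⟨
    + (q ℕ.^ suc L) ℤ.* z ℤ.+ + (q ℕ.^ suc k) ℤ.* a ℤ.- (+ (q ℕ.^ suc L) ℤ.* z ℤ.+ (+ (q ℕ.^ suc k) ℤ.* a ℤ.- a))
      ≡⟨ cong₂ ℤ._-_ (cong (λ a → + (q ℕ.^ suc L) ℤ.* z ℤ.+ + (q ℕ.^ suc k) ℤ.* a) a≡) eq ⟩
    + (q ℕ.^ suc L) ℤ.* z ℤ.+ + (q ℕ.^ suc k) ℤ.* (+ (q ℕ.^ L) ℤ.* b) ℤ.- 0ℤ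
      ≡⟨ cong₂ (λ r s → r ℤ.* z ℤ.+ s ℤ.* (+ (q ℕ.^ L) ℤ.* b) ℤ.- 0ℤ) (ℤ.pos-* q (q ℕ.^ L)) (ℤ.pos-* q (q ℕ.^ k)) ⟩
    + q ℤ.* + (q ℕ.^ L) ℤ.* z ℤ.+ + q ℤ.* + (q ℕ.^ k) ℤ.* (+ (q ℕ.^ L) ℤ.* b) ℤ.- 0ℤ
      ≡⟨ lemma₃ (+ q) (+ (q ℕ.^ L)) (+ (q ℕ.^ k)) z b ⟩
    + q ℤ.* + (q ℕ.^ L) ℤ.* (z ℤ.+ + (q ℕ.^ k) ℤ.* b)
      ≡⟨ cong (ℤ._* (z ℤ.+ + (q ℕ.^ k) ℤ.* b)) (ℤ.pos-* q (q ℕ.^ L)) ⟨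
    + (q ℕ.^ suc L) ℤ.* (z ℤ.+ + (q ℕ.^ k) ℤ.* b)
      ∎)
  where
  open ≡-Reasoning
  lemma₁ : ∀ r q z → r ℤ.* (q ℤ.* z) ≡ q ℤ.* r ℤ.* z
  lemma₁ = solve-∀
  lemma₂ : ∀ u w a → u ℤ.+ w ℤ.- (u ℤ.+ (w ℤ.- a)) ≡ a
  lemma₂ = solve-∀
  lemma₃ : ∀ q r s z n → q ℤ.* r ℤ.* z ℤ.+ q ℤ.* s ℤ.* (r ℤ.* n) ℤ.- 0ℤ ≡ q ℤ.* r ℤ.* (z ℤ.+ s ℤ.* n)
  lemma₃ = solve-∀

  divisible : ∃ λ n → a ≡ + (q ℕ.^ L) ℤ.* n
  divisible = divisible-by-power q L (+ q ℤ.* z) k a (trans (cong (ℤ._+ (+ (q ℕ.^ suc k) ℤ.* a ℤ.- a))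
    (trans (lemma₁ (+ (q ℕ.^ L)) (+ q) z) (cong (ℤ._* z) (sym (ℤ.pos-* q (q ℕ.^ L)))))) eq)

  b : ℤ
  b = proj₁ divisible

  a≡ : a ≡ + (q ℕ.^ L) ℤ.* b
  a≡ = proj₂ divisible

-- Stable reduction and isogenies

module Reduction {q : ℕ} .{{_ : NonZero q}} {c𝔽 ℓ𝔽 c₀ ℓ₀ c ℓ : Level}
                 (𝔽q : FiniteField q c𝔽 ℓ𝔽)
                 (rat : RationalFunctionField (FiniteField.𝔽 𝔽q) c₀ ℓ₀)
                 (ext : FiniteExtension (RationalFunctionField.K₀ rat) c ℓ)
                 (v : Place (FiniteExtension.K ext)) where
  open Drinfeld 𝔽q rat ext
  open DrinfeldModule
  open FiniteExtension ext using (K)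
  private
    module 𝔽 = FiniteField 𝔽q
    module A = Polynomial 𝔽.commutativeRing
    module K = Field K
    module P = TwistedPolynomial q K

  V : Valuation K
  V = placeValuation v

  open P using (Poly; coeff)
  open Place v using (ord; ord-cong; ord-∞; ord-surjective)
  open ValuationProperties V
  open TwistedValuation {q = q} V

  coeff-toList-< : ∀ {r} (g : Vector K.Carrier r) j → coeff (toList g) (toℕ j) ≡ g j
  coeff-toList-< g zero    = refl
  coeff-toList-< g (suc j) = coeff-toList-< (g ∘ suc) j

  coeff-toList-≥ : ∀ {r} (g : Vector K.Carrier r) i → r ℕ.≤ i → coeff (toList g) i ≡ K.0#
  coeff-toList-≥ {zero}  g i       _         = refl
  coeff-toList-≥ {suc r} g (suc i) (s≤s r≤i) = coeff-toList-≥ (g ∘ suc) i r≤i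

  toList-induction : ∀ {p r} (g : Vector K.Carrier r) (Q : ℕ → Set p) →
                     (∀ j → Q (toℕ j)) → (∀ i → r ℕ.≤ i → Q i) → ∀ i → Q i
  toList-induction {r = r} g Q below above i with i ℕ.<? r
  ... | yes i<r = subst Q (Fin.toℕ-fromℕ< i<r) (below (fromℕ< i<r))
  ... | no  i≮r = above i (ℕ.≮⇒≥ i≮r)

  minimum⁺⇒Dominant : ∀ {r} (g : Vector K.Carrier r) → minimum⁺ (ord ∘ g) ≡ [ 0ℤ ] →
                      ∃ (Dominant (ord ∘ coeff (toList g)) 0ℤ)
  minimum⁺⇒Dominant {r} g min≡0
    with Dominant-exists r (ord ∘ coeff (toList g)) (λ i r≤i → trans (cong ord (coeff-toList-≥ g i r≤i)) ord-0)
  ... | inj₁ all⊤ = contradiction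
          (subst (⊤⁺ ≤⁺_) min≡0 (minimum⁺-glb (ord ∘ g) λ j →
            ≤⁺-reflexive (sym (trans (cong ord (sym (coeff-toList-< g j))) (all⊤ (toℕ j)))))) λ ()
  ... | inj₂ (μ , k , D) = k , subst (λ μ → Dominant (ord ∘ coeff (toList g)) μ k)
          (ℤ.≤-antisym ([≤]-injective μ≤0) ([≤]-injective 0≤μ)) D
    where
    μ≤0 : [ μ ] ≤⁺ [ 0ℤ ]
    μ≤0 = subst ([ μ ] ≤⁺_) min≡0 (minimum⁺-glb (ord ∘ g) λ j →
      subst (λ x → [ μ ] ≤⁺ ord x) (coeff-toList-< g j) (bound D (toℕ j)))
    0≤μ : [ 0ℤ ] ≤⁺ [ μ ]
    0≤μ = subst ([ 0ℤ ] ≤⁺_) (attained D) (toList-induction g (λ i → [ 0ℤ ] ≤⁺ ord (coeff (toList g) i))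
      (λ j → subst (λ x → [ 0ℤ ] ≤⁺ ord x) (sym (coeff-toList-< g j))
        (subst (_≤⁺ ord (g j)) min≡0 (minimum⁺-≤ (ord ∘ g) j)))
      (λ i r≤i → subst ([ 0ℤ ] ≤⁺_) (sym (trans (cong ord (coeff-toList-≥ g i r≤i)) ord-0)) (_ ≤⊤⁺))
      k)

  X-degree : A.HasDegree A.X 1
  X-degree = 𝔽.0≉1 ∘ 𝔽.sym , λ { (suc zero) (s≤s ()) ; (suc (suc i)) _ → 𝔽.refl }

  φX : ∀ {r} → DrinfeldModule r → Poly
  φX D = φ D A.X

  module _ {r : ℕ} (D : DrinfeldModule r) where
    private
      deg : P.HasDegree (φX D) r
      deg = subst (P.HasDegree (φX D)) (ℕ.*-identityʳ r) (φ-degree D A.X 1 X-degree)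

    -- Supplies the finite value that `Dominant-target` and `Dominant-source` ask for.
    ord-leading : ∃ λ n → ord (coeff (φX D) r) ≡ [ n ]
    ord-leading = ≉0⇒ord-finite (proj₁ deg)

    twist-beyond-rank : ∀ a b i → r ℕ.< i → twist a b (φX D) i ≡ ⊤⁺
    twist-beyond-rank a b i r<i =
      cong (_+⁺ [ + (q ℕ.^ i) ℤ.* a ℤ.- b ]) (Equivalence.from ord-∞ (proj₂ deg i r<i))

    -- Prepending the integral coefficient T keeps the minimum 0 and shifts the last index by one,
    -- which is why that index is a successor.
    stable⇒Dominant : [ 0ℤ ] ≤⁺ ord (γ A.X) → HasStableReduction D v →
                      ∃₂ λ n k → Dominant (twist n n (φX D)) 0ℤ (suc k)
    stable⇒Dominant 0≤T (x , x≉0 , g , eq , min≡0)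
      with n , x≡n ← ≉0⇒ord-finite x≉0
      with k , G ← minimum⁺⇒Dominant g min≡0
      = n , k , Dominant-cong
          (λ i → trans (ord-cong (K.sym (eq i))) (ord-conjugate x≉0 x≡n (φX D) i))
          (Dominant-tail 0≤T G)

    -- The normalized valuation is onto, so some `u` has value `n` and conjugation by it realizes
    -- the twist. As the last index is positive, the minimum is attained by some gᵢ and not only by
    -- T.
    Dominant⇒stable : ∀ n → Dominant (twist n n (φX D)) 0ℤ (suc k) → HasStableReduction D v
    Dominant⇒stable {k} n G = u , u≉0 , g , reduced , minimal
      where
      u : K.Carrier
      u = proj₁ (ord-surjective n)
      u≡n : ord u ≡ [ n ]
      u≡n = proj₂ (ord-surjective n)
      u≉0 : ¬ (u K.≈ K.0#)
      u≉0 = ord≢⊤⇒≉0 u≡n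
      conjugate : Poly
      conjugate = P.C (K.inv u≉0) P.* φX D P.* P.C u
      G′ : Dominant (ord ∘ coeff conjugate) 0ℤ (suc k)
      G′ = Dominant-cong (λ i → sym (ord-conjugate u≉0 u≡n (φX D) i)) G
      g : Vector K.Carrier r
      g j = coeff conjugate (suc (toℕ j))

      reduced : ∀ i → coeff conjugate i K.≈ coeff (γ A.X ∷ toList g) i
      reduced zero    = K.trans (coeff₀-conjugate u≉0 (φX D)) (φ-coeff₀ D A.X)
      reduced (suc i) = toList-induction g (λ i → coeff conjugate (suc i) K.≈ coeff (toList g) i)
        (λ j → K.reflexive (sym (coeff-toList-< g j)))
        (λ i r≤i → K.trans
          (Equivalence.to ord-∞ (trans (ord-conjugate u≉0 u≡n (φX D) (suc i))
            (twist-beyond-rank n n (suc i) (s≤s r≤i))))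
          (K.reflexive (sym (coeff-toList-≥ g i r≤i))))
        i

      k<r : k ℕ.< r
      -- Coefficients beyond the rank vanish, so the finite minimum is not attained there.
      k<r = ℕ.≰⇒> λ r≤k → contradiction
        (trans (sym (attained G)) (twist-beyond-rank n n (suc k) (s≤s r≤k))) λ ()

      minimal : minimum⁺ (ord ∘ g) ≡ [ 0ℤ ]
      minimal = ≤⁺-antisym
        (subst (minimum⁺ (ord ∘ g) ≤⁺_)
          (trans (cong (λ i → ord (coeff conjugate (suc i))) (Fin.toℕ-fromℕ< k<r)) (attained G′))
          (minimum⁺-≤ (ord ∘ g) (fromℕ< k<r)))
        (minimum⁺-glb (ord ∘ g) λ j → bound G′ (suc (toℕ j)))

  module _ {r s : ℕ} (D : DrinfeldModule r) (E : DrinfeldModule s) (f : Poly)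
           (isogeny : IsIsogeny D E f) (0≤T : [ 0ℤ ] ≤⁺ ord (γ A.X)) where
    private
      f≉0 : ¬ (∀ i → ord (coeff f i) ≡ ⊤⁺)
      f≉0 all⊤ = proj₁ isogeny λ i → Equivalence.to ord-∞ (all⊤ i)

    stable-target : HasStableReduction D v → HasStableReduction E v
    stable-target stable
      with a , k , G ← stable⇒Dominant D 0≤T stable
      with Dominant-exists (List.length f) (twist a 0ℤ f) (twist-⊤ a 0ℤ f)
    ... | inj₁ all⊤ = contradiction (λ i → Equivalence.from ord-∞ (twist-≡⊤ a 0ℤ f (all⊤ i))) f≉0
    -- Taking for `b` the minimum of ord fᵢ + qⁱ a gives `f` minimum 0 for (a, b).
    ... | inj₂ (b , d , F) = Dominant⇒stable E b
          (Dominant-target {f} {φX D} {φX E} (proj₂ isogeny A.X) (Dominant-shift a f F) (proj₂ (ord-leading E)) G)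

    stable-source : HasStableReduction E v → HasStableReduction D v
    stable-source stable = conclude (stable⇒Dominant E 0≤T stable)
      where
      L N : ℕ
      -- All nonzero coefficients of `f` have index below `L`, so after scaling by N = q^L the
      -- divisions by qⁱ stay within ℤ.
      L = List.length f
      N = q ℕ.^ L

      instance
        N≢0 : NonZero N
        N≢0 = ℕ.m^n≢0 q L

      module W = TwistedValuation {q = q} (scale N V)

      W-twist : ∀ n g i → W.twist (+ N ℤ.* n) (+ N ℤ.* n) g i ≡ N ·⁺ twist n n g i
      W-twist n g i with ord (coeff g i)
      ... | ⊤⁺    = refl
      ... | [ x ] = cong [_] (lemma (+ N) x (+ (q ℕ.^ i)) n)
        where
        lemma : ∀ N x p n → N ℤ.* x ℤ.+ (p ℤ.* (N ℤ.* n) ℤ.- N ℤ.* n) ≡ N ℤ.* (x ℤ.+ (p ℤ.* n ℤ.- n))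
        lemma = solve-∀

      -- The required a is the largest of the numbers N (b − ord fᵢ) / qⁱ = − slope b i.
      slope : ℤ → ℕ → ℤ ⁺
      slope b i = (q ℕ.^ (L ℕ.∸ i)) ·⁺ (ord (coeff f i) +⁺ [ ℤ.- b ])

      slope-⊤ : ∀ b i → L ℕ.≤ i → slope b i ≡ ⊤⁺
      slope-⊤ b i L≤i = cong (λ x → (q ℕ.^ (L ℕ.∸ i)) ·⁺ (x +⁺ [ ℤ.- b ])) (ord-beyond-length f i L≤i)

      normalize : ∀ b → ∃₂ λ a d → Dominant (W.twist a (+ N ℤ.* b) f) 0ℤ d
      normalize b with Dominant-exists L (slope b) (slope-⊤ b)
      ... | inj₁ all⊤ = contradiction (λ i → ⊤-slope (q ℕ.^ (L ℕ.∸ i)) (ord (coeff f i)) (all⊤ i)) f≉0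
        where
        ⊤-slope : ∀ e x → e ·⁺ (x +⁺ [ ℤ.- b ]) ≡ ⊤⁺ → x ≡ ⊤⁺
        ⊤-slope e ⊤⁺ _ = refl
      -- Multiplied by qⁱ, the inequality `μ ≤ slope b i` says that the scaled Gauss value at i is
      -- at least 0, with equality at `e`.
      ... | inj₂ (μ , e , S) = ℤ.- μ , Dominant-last {k = e} L (W.twist-⊤ _ _ f) bounded touched
        where
        factor : ∀ i → i ℕ.≤ L → + N ≡ + (q ℕ.^ i) ℤ.* + (q ℕ.^ (L ℕ.∸ i))
        factor i i≤L = trans
          (cong +_ (trans (cong (q ℕ.^_) (sym (ℕ.m+[n∸m]≡n i≤L))) (ℕ.^-distribˡ-+-* q i (L ℕ.∸ i))))
          (ℤ.pos-* (q ℕ.^ i) (q ℕ.^ (L ℕ.∸ i)))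

        W-slope : ∀ i → i ℕ.≤ L → W.twist (ℤ.- μ) (+ N ℤ.* b) f i ≡
                  (q ℕ.^ i) ·⁺ (slope b i +⁺ [ ℤ.- μ ])
        W-slope i i≤L with ord (coeff f i)
        ... | ⊤⁺    = refl
        ... | [ x ] = cong [_] (trans
          (cong (λ N → N ℤ.* x ℤ.+ (+ (q ℕ.^ i) ℤ.* (ℤ.- μ) ℤ.- N ℤ.* b)) (factor i i≤L))
          (lemma (+ (q ℕ.^ i)) (+ (q ℕ.^ (L ℕ.∸ i))) x μ b))
          where
          lemma : ∀ p r x μ b → p ℤ.* r ℤ.* x ℤ.+ (p ℤ.* (ℤ.- μ) ℤ.- p ℤ.* r ℤ.* b) ≡
                                p ℤ.* (r ℤ.* (x ℤ.+ ℤ.- b) ℤ.+ ℤ.- μ)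
          lemma = solve-∀

        bounded : ∀ i → [ 0ℤ ] ≤⁺ W.twist (ℤ.- μ) (+ N ℤ.* b) f i
        bounded i with i ℕ.≤? L
        ... | no  i≰L = subst ([ 0ℤ ] ≤⁺_) (sym (W.twist-⊤ _ _ f i (ℕ.<⇒≤ (ℕ.≰⇒> i≰L)))) (_ ≤⊤⁺)
        ... | yes i≤L = subst₂ _≤⁺_ (cong [_] (ℤ.*-zeroʳ (+ (q ℕ.^ i)))) (sym (W-slope i i≤L))
          (·⁺-mono (q ℕ.^ i) (+⁺-shift (subst (λ n → [ n ] ≤⁺ _) (lemma μ) (bound S i))))
          where
          lemma : ∀ μ → μ ≡ 0ℤ ℤ.- (ℤ.- μ)
          lemma = solve-∀

        touched : W.twist (ℤ.- μ) (+ N ℤ.* b) f e ≡ [ 0ℤ ]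
        touched with e ℕ.≤? L
        ... | yes e≤L = trans (W-slope e e≤L) (trans
          (cong (λ y → (q ℕ.^ e) ·⁺ (y +⁺ [ ℤ.- μ ])) (attained S))
          (cong [_] (trans (cong (+ (q ℕ.^ e) ℤ.*_) (ℤ.+-inverseʳ μ)) (ℤ.*-zeroʳ (+ (q ℕ.^ e))))))
        ... | no  e≰L = contradiction (trans (sym (attained S))
          (slope-⊤ b e (ℕ.<⇒≤ (ℕ.≰⇒> e≰L)))) λ ()

      -- With z the value of the coefficient of τ^(k+1), the hypothesis is the relation N z +
      -- (q^(k+1) - 1) a = 0.
      integral : ∀ a k → W.twist a a (φX D) (suc k) ≡ [ 0ℤ ] → ∃ λ n → a ≡ + N ℤ.* n
      integral a k eq with ord (coeff (φX D) (suc k))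
      ... | [ z ] = divisible-by-power q L z k a ([]-injective eq)

      descend : ∀ k a → Dominant (W.twist a a (φX D)) 0ℤ (suc k) →
                (∃ λ n → a ≡ + N ℤ.* n) → HasStableReduction D v
      descend k a G (n , a≡Nn) = Dominant⇒stable D n (Dominant-unscale N (Dominant-cong (W-twist n (φX D))
        (subst (λ a → Dominant (W.twist a a (φX D)) 0ℤ (suc k)) a≡Nn G)))

      source : ∀ b k → Dominant (twist b b (φX E)) 0ℤ (suc k) →
               (∃₂ λ a d → Dominant (W.twist a (+ N ℤ.* b) f) 0ℤ d) →
               ∃ λ a → Dominant (W.twist a a (φX D)) 0ℤ (suc k)
      source b k H (a , d , F) = a , W.Dominant-source {f} {φX D} {φX E} (proj₂ isogeny A.X) F
        (cong (N ·⁺_) (proj₂ (ord-leading D)))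
        (Dominant-cong (λ i → sym (W-twist b (φX E) i)) (Dominant-scale N H))

      conclude : (∃₂ λ b k → Dominant (twist b b (φX E)) 0ℤ (suc k)) → HasStableReduction D v
      conclude (b , k , H) = let a , G = source b k H (normalize b) in
        descend k a G (integral a k (attained G))

-- Places at which T is not integral

module InfinitePlace {q : ℕ} {c𝔽 ℓ𝔽 c₀ ℓ₀ c ℓ : Level}
                     (𝔽q : FiniteField q c𝔽 ℓ𝔽)
                     (rat : RationalFunctionField (FiniteField.𝔽 𝔽q) c₀ ℓ₀)
                     (ext : FiniteExtension (RationalFunctionField.K₀ rat) c ℓ)
                     (v : Place (FiniteExtension.K ext)) where
  open Drinfeld 𝔽q rat ext
  open RationalFunctionField rat using (K₀; fromA; fromA-mono; fraction)
  open FiniteExtension ext using (K; ι; ι-homo)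
  private
    module 𝔽  = FiniteField 𝔽q
    module A  = Polynomial 𝔽.commutativeRing
    module K₀ = Field K₀
    module K  = Field K
    module fromA = IsRingMonomorphism fromA-mono
    module ι = IsRingHomomorphism ι-homo
  open Place v using (ord; ord-cong; ord-∞; ord-*; ord-+)
  open ValuationProperties (placeValuation v)
  open SkewPolynomialProperties 𝔽.commutativeRing id using (coeff-+; coeff-map)
  open Inverse 𝔽.enumeration using (to; from; strictlyInverseˡ)

  from-injective : ∀ {a b} → from a ≡ from b → a 𝔽.≈ b
  from-injective {a} {b} eq = 𝔽.trans (𝔽.sym (strictlyInverseˡ a))
    (𝔽.trans (𝔽.reflexive (cong to eq)) (strictlyInverseˡ b))

  infix 4 _≈0?
  _≈0? : ∀ a → Dec (a 𝔽.≈ 𝔽.0#)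
  a ≈0? = map′ from-injective (Inverse.from-cong 𝔽.enumeration) (from a Fin.≟ from 𝔽.0#)

  -- Lists may end in zeros, so the degree is found by testing coefficients, which the enumeration
  -- of the finite field makes decidable.
  degree : ∀ f → (∀ i → A.coeff f i 𝔽.≈ 𝔽.0#) ⊎ ∃ (A.HasDegree f)
  degree []      = inj₁ λ _ → 𝔽.refl
  degree (a ∷ f) with degree f | a ≈0?
  ... | inj₂ (d , f_d≉0 , f≈0) | _ = inj₂ (suc d , f_d≉0 , λ { (suc i) (s≤s d<i) → f≈0 i d<i })
  ... | inj₁ f≈0 | yes a≈0 = inj₁ λ { zero → a≈0 ; (suc i) → f≈0 i }
  ... | inj₁ f≈0 | no  a≉0 = inj₂ (0 , a≉0 , λ { (suc i) _ → f≈0 i })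

  γ-cong : ∀ {f g} → (∀ i → A.coeff f i 𝔽.≈ A.coeff g i) → γ f K.≈ γ g
  γ-cong f≈g = ι.⟦⟧-cong (fromA.⟦⟧-cong f≈g)

  γ-+ : ∀ f g → γ (f A.+ g) K.≈ γ f K.+ γ g
  γ-+ f g = K.trans (ι.⟦⟧-cong (fromA.+-homo f g)) (ι.+-homo (fromA f) (fromA g))

  γ-* : ∀ f g → γ (f A.* g) K.≈ γ f K.* γ g
  γ-* f g = K.trans (ι.⟦⟧-cong (fromA.*-homo f g)) (ι.*-homo (fromA f) (fromA g))

  γ-0 : γ [] K.≈ K.0#
  γ-0 = K.trans (ι.⟦⟧-cong fromA.0#-homo) ι.0#-homo

  γ-1 : γ (A.C 𝔽.1#) K.≈ K.1#
  γ-1 = K.trans (ι.⟦⟧-cong fromA.1#-homo) ι.1#-homo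

  -- Horner's rule; it lets values of polynomials be computed by recursion on the list.
  ∷-≈ : ∀ a f i → A.coeff (a ∷ f) i 𝔽.≈ A.coeff (A.C a A.+ A.X A.* f) i
  ∷-≈ a f i = 𝔽.sym (𝔽.trans (coeff-+ (A.C a) (A.X A.* f) i)
    (𝔽.trans (𝔽.+-congˡ (coeff-+ (map (𝔽.0# 𝔽.*_) f) _ i))
    (𝔽.trans (𝔽.+-congˡ (𝔽.trans (𝔽.+-congʳ (𝔽.trans (coeff-map (𝔽.zeroʳ _) f i) (𝔽.zeroˡ _))) (𝔽.+-identityˡ _)))
      (shifted i))))
    where
    shifted : ∀ i → A.coeff (A.C a) i 𝔽.+ A.coeff (𝔽.0# ∷ A.C 𝔽.1# A.* map id f) i 𝔽.≈ A.coeff (a ∷ f) i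
    shifted zero    = 𝔽.+-identityʳ a
    shifted (suc i) = 𝔽.trans (𝔽.+-identityˡ _)
      (𝔽.trans (coeff-+ (map (𝔽.1# 𝔽.*_) (map id f)) _ i)
      (𝔽.trans (𝔽.+-cong (coeff-map (𝔽.zeroʳ _) (map id f) i) (zeros i))
      (𝔽.trans (𝔽.+-identityʳ _)
      (𝔽.trans (𝔽.*-identityˡ _) (coeff-map 𝔽.refl f i)))))
      where
      zeros : ∀ i → A.coeff (𝔽.0# ∷ []) i 𝔽.≈ 𝔽.0#
      zeros zero    = 𝔽.refl
      zeros (suc i) = 𝔽.refl

  γ-∷ : ∀ a f → γ (a ∷ f) K.≈ γ (A.C a) K.+ γ A.X K.* γ f
  γ-∷ a f = K.trans (γ-cong (∷-≈ a f)) (K.trans (γ-+ (A.C a) (A.X A.* f)) (K.+-congˡ (γ-* A.X f)))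

  C-cong : ∀ {a b} → a 𝔽.≈ b → γ (A.C a) K.≈ γ (A.C b)
  C-cong a≈b = γ-cong λ { zero → a≈b ; (suc i) → 𝔽.refl }

  γ-C-* : ∀ a b → γ (A.C (a 𝔽.* b)) K.≈ γ (A.C a) K.* γ (A.C b)
  γ-C-* a b = K.trans (C-cong (𝔽.sym (𝔽.+-identityʳ (a 𝔽.* b)))) (γ-* (A.C a) (A.C b))

  open RawSemiringDefinitions (RawRing.rawSemiring 𝔽.rawRing) using (_^_)

  ord-C-^ : ∀ {a} → ord (γ (A.C a)) ≡ [ n ] → ∀ i → ord (γ (A.C (a ^ i))) ≡ [ + i ℤ.* n ]
  ord-C-^ {n} a≡n zero    = trans (ord-cong γ-1) ord-1
  ord-C-^ {n} {a} a≡n (suc i) = trans (ord-cong (γ-C-* a (a ^ i))) (trans (ord-* _ _)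
    (trans (cong₂ _+⁺_ a≡n (ord-C-^ a≡n i)) (cong [_] (sym (ℤ.suc-* (+ i) n)))))

  -- A nonzero constant is a unit, and `γ` carries its inverse to an inverse of its image.
  γ-C≉0 : ∀ {a} → ¬ (a 𝔽.≈ 𝔽.0#) → ¬ (γ (A.C a) K.≈ K.0#)
  γ-C≉0 {a} a≉0 γa≈0 = K.0≉1 (begin
    K.0#                                ≈⟨ K.zeroʳ _ ⟨
    γ (A.C (𝔽.inv a≉0)) K.* K.0#        ≈⟨ K.*-congˡ γa≈0 ⟨
    γ (A.C (𝔽.inv a≉0)) K.* γ (A.C a)   ≈⟨ γ-C-* (𝔽.inv a≉0) a ⟨
    γ (A.C (𝔽.inv a≉0 𝔽.* a))           ≈⟨ C-cong (proj₁ (proj₂ (𝔽.invertible a≉0))) ⟩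
    γ (A.C 𝔽.1#)                        ≈⟨ γ-1 ⟩
    K.1#                                ∎)
    where open SetoidReasoning K.setoid

  -- Two of the powers 1, a, …, a^q coincide, so a is a root of unity.
  ord-C : ∀ {a} → ¬ (a 𝔽.≈ 𝔽.0#) → ord (γ (A.C a)) ≡ [ 0ℤ ]
  ord-C {a} a≉0
    with n , a≡n ← ≉0⇒ord-finite (γ-C≉0 a≉0)
    with i , j , i<j , eq ← Fin.pigeonhole (ℕ.n<1+n q) (λ i → from (a ^ toℕ i))
    with in≡jn ← []-injective (trans (sym (ord-C-^ a≡n (toℕ i)))
           (trans (ord-cong (C-cong (from-injective eq))) (ord-C-^ a≡n (toℕ j))))
    with n ℤ.≟ 0ℤ
  ... | yes refl = a≡n
  ... | no  n≢0  = contradiction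
    (ℤ.+-injective (ℤ.*-cancelʳ-≡ (+ toℕ i) (+ toℕ j) n {{ℤ.≢-nonZero n≢0}} in≡jn)) (ℕ.<⇒≢ i<j)

  ord-C-≥0 : ∀ a → [ 0ℤ ] ≤⁺ ord (γ (A.C a))
  ord-C-≥0 a with a ≈0?
  ... | no  a≉0 = ≤⁺-reflexive (sym (ord-C a≉0))
  ... | yes a≈0 = subst ([ 0ℤ ] ≤⁺_) (sym (Equivalence.from ord-∞
          (K.trans (γ-cong λ { zero → a≈0 ; (suc i) → 𝔽.refl }) γ-0))) (_ ≤⊤⁺)

  -- The powers of T, which serve as elements of prescribed degree in `ord₀-surjective`.
  monomial : ℕ → A.Poly
  monomial zero    = A.C 𝔽.1#
  monomial (suc d) = 𝔽.0# ∷ monomial d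

  monomial-degree : ∀ d → A.HasDegree (monomial d) d
  monomial-degree zero    = 𝔽.0≉1 ∘ 𝔽.sym , λ { (suc i) _ → 𝔽.refl }
  monomial-degree (suc d) = proj₁ (monomial-degree d) ,
    λ { (suc i) (s≤s d<i) → proj₂ (monomial-degree d) i d<i }

  module _ (e-1 : ℕ) (ord-T : ord (γ A.X) ≡ [ -[1+ e-1 ] ]) where
    private
      e = suc e-1

    -- In a + T f with `f` nonzero, the term T f has negative value and the constant has value at
    -- least 0, so T f determines the value.
    ord-γ : ∀ f d → A.HasDegree f d → ord (γ f) ≡ e ·⁺ [ ℤ.- (+ d) ]
    ord-γ []      d       (0≉0 , _)   = contradiction 𝔽.refl 0≉0
    ord-γ (a ∷ f) zero    (a≉0 , f≈0) =
      trans (ord-cong (γ-cong λ { zero → 𝔽.refl ; (suc i) → f≈0 (suc i) (s≤s z≤n) }))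
        (trans (ord-C a≉0) (cong [_] (sym (ℤ.*-zeroʳ (+ e)))))
    ord-γ (a ∷ f) (suc d) (f_d≉0 , f≈0) = trans (ord-cong (K.trans (γ-∷ a f) (K.+-comm _ _)))
      (ord-+-dominant _ _
        (trans (ord-* (γ A.X) (γ f)) (trans
          (cong₂ _+⁺_ ord-T (ord-γ f d (f_d≉0 , λ i d<i → f≈0 (suc i) (s≤s d<i))))
          (cong [_] (lemma (+ e) (+ d)))))
        -- The explicit argument comes from e (d + 1) = 1 + (d + (e - 1)(d + 1)).
        (≤⁺-trans [ ℤ.i<j⇒suc[i]≤j (ℤ.-<+ {d ℕ.+ e-1 ℕ.* suc d}) ]≤ (ord-C-≥0 a)))
      where
      lemma : ∀ e d → ℤ.- e ℤ.+ e ℤ.* (ℤ.- d) ≡ e ℤ.* (ℤ.- (1ℤ ℤ.+ d))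
      lemma = solve-∀

    -- For x = a / b with a nonzero, z is deg b - deg a. The last component is half of `ord-∞` for
    -- the valuation on `K₀`.
    value : ∀ x → ∃ λ z → ord (ι x) ≡ e ·⁺ z × (z ≡ ⊤⁺ → x K₀.≈ K₀.0#)
    value x with a , b , b≉0 , xb≈a ← fraction x with degree a | degree b
    ... | _ | inj₁ b≈0 = contradiction (K₀.trans (fromA.⟦⟧-cong b≈0) fromA.0#-homo) b≉0
    ... | inj₁ a≈0 | inj₂ _ = ⊤⁺ , Equivalence.from ord-∞ (K.trans (ι.⟦⟧-cong x≈0) ι.0#-homo) , λ _ → x≈0
      where
      b⁻¹ = K₀.inv b≉0
      x≈0 : x K₀.≈ K₀.0#
      x≈0 = begin
        x                          ≈⟨ K₀.*-identityʳ x ⟨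
        x K₀.* K₀.1#               ≈⟨ K₀.*-congˡ (proj₂ (proj₂ (K₀.invertible b≉0))) ⟨
        x K₀.* (fromA b K₀.* b⁻¹)  ≈⟨ K₀.*-assoc x (fromA b) b⁻¹ ⟨
        x K₀.* fromA b K₀.* b⁻¹    ≈⟨ K₀.*-congʳ xb≈a ⟩
        fromA a K₀.* b⁻¹           ≈⟨ K₀.*-congʳ (K₀.trans (fromA.⟦⟧-cong a≈0) fromA.0#-homo) ⟩
        K₀.0# K₀.* b⁻¹             ≈⟨ K₀.zeroˡ b⁻¹ ⟩
        K₀.0#                      ∎
        where open SetoidReasoning K₀.setoid
    ... | inj₂ (dₐ , A-deg) | inj₂ (d_b , B-deg) = [ + d_b ℤ.- + dₐ ] , quotient (ord (ι x)) (begin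
        ord (ι x) +⁺ e ·⁺ [ ℤ.- (+ d_b) ]  ≡⟨ cong (ord (ι x) +⁺_) (ord-γ b d_b B-deg) ⟨
        ord (ι x) +⁺ ord (γ b)             ≡⟨ ord-* (ι x) (γ b) ⟨
        ord (ι x K.* γ b)                  ≡⟨ ord-cong (K.trans (K.sym (ι.*-homo x (fromA b))) (ι.⟦⟧-cong xb≈a)) ⟩
        ord (γ a)                          ≡⟨ ord-γ a dₐ A-deg ⟩
        e ·⁺ [ ℤ.- (+ dₐ) ]                ∎) , λ ()
      where
      open ≡-Reasoning
      quotient : ∀ y → y +⁺ e ·⁺ [ ℤ.- (+ d_b) ] ≡ e ·⁺ [ ℤ.- (+ dₐ) ] →
                 y ≡ e ·⁺ [ + d_b ℤ.- + dₐ ]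
      quotient [ y ] eq = cong [_] (trans (lemma₁ y (+ e) (+ d_b))
        (trans (cong (ℤ._+ + e ℤ.* + d_b) ([]-injective eq)) (lemma₂ (+ e) (+ d_b) (+ dₐ))))
        where
        lemma₁ : ∀ y e b → y ≡ y ℤ.+ e ℤ.* (ℤ.- b) ℤ.+ e ℤ.* b
        lemma₁ = solve-∀
        lemma₂ : ∀ e b a → e ℤ.* (ℤ.- a) ℤ.+ e ℤ.* b ≡ e ℤ.* (b ℤ.- a)
        lemma₂ = solve-∀

    ord₀ : K₀.Carrier → ℤ ⁺
    ord₀ x = proj₁ (value x)

    ord-ι : ∀ x → ord (ι x) ≡ e ·⁺ ord₀ x
    ord-ι x = proj₁ (proj₂ (value x))

    -- As e ≥ 1, ord (ι x) determines z, whatever fraction was chosen for x. The laws of `ord₀` thus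
    -- descend from those of `ord`.
    ord₀-unique : ∀ x z → ord (ι x) ≡ e ·⁺ z → ord₀ x ≡ z
    ord₀-unique x z eq = ·⁺-injective e (ord₀ x) z (trans (sym (ord-ι x)) eq)

    valuation₀ : Valuation K₀
    valuation₀ = record
      { ord      = ord₀
      ; ord-cong = λ {x} {y} x≈y → ord₀-unique x (ord₀ y) (trans (ord-cong (ι.⟦⟧-cong x≈y)) (ord-ι y))
      ; ord-∞    = λ {x} → mk⇔ (proj₂ (proj₂ (value x)))
          (λ x≈0 → ord₀-unique x ⊤⁺ (Equivalence.from ord-∞ (K.trans (ι.⟦⟧-cong x≈0) ι.0#-homo)))
      ; ord-*    = λ x y → ord₀-unique (x K₀.* y) (ord₀ x +⁺ ord₀ y)
          (trans (ord-cong (ι.*-homo x y)) (trans (ord-* (ι x) (ι y))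
            (trans (cong₂ _+⁺_ (ord-ι x) (ord-ι y)) (sym (·⁺-distribˡ e (ord₀ x) (ord₀ y))))))
      ; ord-+    = λ x y → ·⁺-cancel-≤ e (ord₀ x ⊓⁺ ord₀ y) (ord₀ (x K₀.+ y))
          (subst (e ·⁺ (ord₀ x ⊓⁺ ord₀ y) ≤⁺_) (trans (ord-cong (K.sym (ι.+-homo x y))) (ord-ι (x K₀.+ y)))
            (ord-+-glb (ι x) (ι y)
              (subst (e ·⁺ (ord₀ x ⊓⁺ ord₀ y) ≤⁺_) (sym (ord-ι x)) (·⁺-mono e (x⊓y≤x (ord₀ x) (ord₀ y))))
              (subst (e ·⁺ (ord₀ x ⊓⁺ ord₀ y) ≤⁺_) (sym (ord-ι y)) (·⁺-mono e (x⊓y≤y (ord₀ x) (ord₀ y))))))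
      }

    ord₀-fromA : ∀ f d → A.HasDegree f d → ord₀ (fromA f) ≡ [ ℤ.- (+ d) ]
    ord₀-fromA f d f-deg = ord₀-unique (fromA f) [ ℤ.- (+ d) ] (ord-γ f d f-deg)

    ord₀-surjective : ∀ n → ∃ λ x → ord₀ x ≡ [ n ]
    ord₀-surjective -[1+ d ] = fromA (monomial (suc d)) , ord₀-fromA _ (suc d) (monomial-degree (suc d))
    ord₀-surjective (+ d)    = K₀.inv T^d≉0 ,
      trans (ValuationProperties.ord-inv valuation₀ T^d≉0 T^d≡-d) (cong [_] (ℤ.neg-involutive (+ d)))
      where
      T^d≡-d : ord₀ (fromA (monomial d)) ≡ [ ℤ.- (+ d) ]
      T^d≡-d = ord₀-fromA (monomial d) d (monomial-degree d)
      T^d≉0 : ¬ (fromA (monomial d) K₀.≈ K₀.0#)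
      T^d≉0 = ValuationProperties.ord≢⊤⇒≉0 valuation₀ T^d≡-d

    place₀ : Place K₀
    place₀ = record { Valuation valuation₀ ; ord-surjective = ord₀-surjective }

    isInfinite : IsInfinite v
    -- The ramification index is e = -ord T, because T has value -1 at the place ∞.
    isInfinite = place₀ , ord₀-fromA , e , _ , ord-ι

  finite⇒ord-T≥0 : IsFinite v → [ 0ℤ ] ≤⁺ ord (γ A.X)
  finite⇒ord-T≥0 finite with ord (γ A.X) in eq
  ... | ⊤⁺           = _ ≤⊤⁺
  ... | [ + n ]      = [ ℤ.+≤+ z≤n ]≤
  ... | [ -[1+ e ] ] = contradiction (isInfinite e eq) finite

proposition4p10 : ∀ {c𝔽 ℓ𝔽 c₀ ℓ₀ c ℓ : Level} {q : ℕ}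
    (𝔽q : FiniteField q c𝔽 ℓ𝔽)
    (rat : RationalFunctionField (FiniteField.𝔽 𝔽q) c₀ ℓ₀)
    (ext : FiniteExtension (RationalFunctionField.K₀ rat) c ℓ) →
    let open Drinfeld 𝔽q rat ext in
    ∀ {r s : ℕ} (φ : DrinfeldModule r) (ψ : DrinfeldModule s) →
    Isogenous φ ψ →
    (v : Place (FiniteExtension.K ext)) → IsFinite v →
    HasStableReduction φ v ⇔ HasStableReduction ψ v
proposition4p10 {q = q} 𝔽q rat ext φ ψ (f , isogeny) v finite =
  mk⇔ (stable-target φ ψ f isogeny ord-T≥0) (stable-source φ ψ f isogeny ord-T≥0)
  where
  instance
    q≢0 : NonZero q
    -- The index of the zero element inhabits `Fin q`.
    q≢0 = nonZeroIndex (Inverse.from (FiniteField.enumeration 𝔽q) (FiniteField.0# 𝔽q))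
  open InfinitePlace 𝔽q rat ext v using (finite⇒ord-T≥0)
  open Reduction 𝔽q rat ext v using (stable-target; stable-source)
  ord-T≥0 = finite⇒ord-T≥0 finite
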